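{- For any $n \in \mathbb{Z}$, the following are equivalent: (1) The image of $\left(n^{\frac{k_p+1}{2}}\right)_{p \in \mathbb{P}} \in \mathbb{Z}^{\mathbb{P}}$ in $\mathscr{A}$ is transcendental over $\mathbb{Q}$. (2) The inequality $|n| > 1$ holds.
   Context: $\mathbb{P}$ denotes the set of prime numbers; $\mathbb{F}_p = \mathbb{Z}/p\mathbb{Z}$. For $p \in \mathbb{P}$, $k_p$ denotes the greatest odd divisor of $p-1$. The ring $\mathscr{A}$ of integers modulo infinitely large primes is $\mathscr{A} = \prod_{p \in \mathbb{P}} \mathbb{F}_p \big/ \bigoplus_{p \in \mathbb{P}} \mathbb{F}_p$, a commutative $\mathbb{Q}$-algebra (each nonzero integer is invertible modulo all but finitely many primes). The image in $\mathscr{A}$ of a sequence of integers $(a(p))_{p \in \mathbb{P}}$ is the class of $(a(p) \bmod p)_{p \in \mathbb{P}}$. An element $\alpha \in \mathscr{A}$ is (naively) algebraic over $\mathbb{Q}$ if there is a nonzero $g \in \mathbb{Q}[x]$ with $g(\alpha) = 0$ in $\mathscr{A}$, and (naively) transcendental over $\mathbb{Q}$ otherwise. -}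

module Defs where

open import Algebra.Bundles using (CommutativeRing)
import Algebra.Properties.Group as GroupProperties
import Algebra.Properties.Ring as RingProperties
open import Algebra.Morphism.Structures using (IsRingHomomorphism)
import Algebra.Solver.Ring.NaturalCoefficients.Default as SemiringSolver
open import Data.Integer.Base as ℤ using (ℤ; +_; 0ℤ; 1ℤ)
import Data.Integer.Divisibility.Signed as ℤ
import Data.Integer.Properties as ℤ
open import Data.Integer.Tactic.RingSolver using (solve-∀)
open import Data.Irrelevant using ([_])
open import Data.List.Base using (List; []; _∷_; _++_; filter; foldr; upTo)
open import Data.List.Extrema.Nat using (max; xs≤max; argmax-all)
open import Data.List.Membership.Propositional using (_∈_; _∉_)
open import Data.List.Membership.Propositional.Properties
  using (∈-++⁺ˡ; ∈-++⁺ʳ; ∈-filter⁺; ∈-upTo⁺)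
open import Data.List.Relation.Unary.All as All using ()
open import Data.List.Relation.Unary.All.Properties using (all-filter)
open import Data.List.Relation.Unary.Any using (Any; here; there)
open import Data.Nat.Base as ℕ using (ℕ; zero; suc; _≤_; s≤s; z≤n; NonZero)
open import Data.Nat.Coprimality using (Coprime; prime⇒coprime; coprime⇒gcd≡1)
open import Data.Nat.Divisibility using (_∣_; _∤_; _∣?_; 1∣_; ∣⇒≤; ∣1⇒≡1)
open import Data.Nat.GCD using (gcd; gcd-GCD; module Bézout)
open import Data.Nat.Primality using (Prime; prime?; prime⇒nonZero)
import Data.Nat.Properties as ℕ
open import Data.Product.Base using (_×_; _,_; Σ-syntax)
open import Data.Rational.Base as ℚ using (ℚ; 0ℚ; ↥_; ↧ₙ_; toℚᵘ)
import Data.Rational.Properties as ℚ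
open import Data.Rational.Unnormalised.Base as ℚᵘ using (ℚᵘ; *≡*)
open import Data.Refinement using (Refinement-syntax; _,_; value)
open import Function.Base using (_∘_)
open import Level using (0ℓ)
open import Relation.Binary.PropositionalEquality as ≡
  using (_≡_; _≢_; refl; cong; subst)
open import Relation.Nullary using (¬_; ¬?; yes; no; recompute; contradiction)
open import Relation.Nullary.Decidable using (_×-dec_)

ℙ : Set
ℙ = [ p ∈ ℕ ∣ Prime p ]

-- ℤ/nℤ as a setoid: integers up to congruence modulo n.  Congruence is a record
-- so that the two integers can be inferred from it.

infix 4 _≡_[mod_]
record _≡_[mod_] (a b : ℤ) (n : ℕ) : Set where
  constructor congruent
  field divides-difference : + n ℤ.∣ a ℤ.- b

module _ (n : ℕ) where

  private
    infix 4 _≈_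
    _≈_ : ℤ → ℤ → Set
    a ≈ b = a ≡ b [mod n ]

    via : ∀ {a b e} → e ≡ a ℤ.- b → + n ℤ.∣ e → a ≈ b
    via refl d = congruent d

    ≡⇒≈ : ∀ {a b} → a ≡ b → a ≈ b
    ≡⇒≈ {a} refl = via (≡.sym (ℤ.+-inverseʳ a)) (ℤ.divides 0ℤ refl)

    ≈-sym : ∀ {a b} → a ≈ b → b ≈ a
    ≈-sym {a} {b} (congruent d) = via (eq a b) (ℤ.∣m⇒∣-m d)
      where
      eq : ∀ a b → ℤ.- (a ℤ.- b) ≡ b ℤ.- a
      eq = solve-∀

    ≈-trans : ∀ {a b c} → a ≈ b → b ≈ c → a ≈ c
    ≈-trans {a} {b} {c} (congruent d) (congruent e) = via (eq a b c) (ℤ.∣m∣n⇒∣m+n d e)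
      where
      eq : ∀ a b c → (a ℤ.- b) ℤ.+ (b ℤ.- c) ≡ a ℤ.- c
      eq = solve-∀

    +-cong : ∀ {a b c d} → a ≈ b → c ≈ d → a ℤ.+ c ≈ b ℤ.+ d
    +-cong {a} {b} {c} {d} (congruent p) (congruent q) = via (eq a b c d) (ℤ.∣m∣n⇒∣m+n p q)
      where
      eq : ∀ a b c d → (a ℤ.- b) ℤ.+ (c ℤ.- d) ≡ (a ℤ.+ c) ℤ.- (b ℤ.+ d)
      eq = solve-∀

    *-cong : ∀ {a b c d} → a ≈ b → c ≈ d → a ℤ.* c ≈ b ℤ.* d
    *-cong {a} {b} {c} {d} (congruent p) (congruent q) = via (eq a b c d)
      (ℤ.∣m∣n⇒∣m+n (ℤ.∣m⇒∣m*n c p) (ℤ.∣n⇒∣m*n b q))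
      where
      eq : ∀ a b c d → (a ℤ.- b) ℤ.* c ℤ.+ b ℤ.* (c ℤ.- d) ≡ a ℤ.* c ℤ.- b ℤ.* d
      eq = solve-∀

    -‿cong : ∀ {a b} → a ≈ b → ℤ.- a ≈ ℤ.- b
    -‿cong {a} {b} (congruent p) = via (eq a b) (ℤ.∣m⇒∣-m p)
      where
      eq : ∀ a b → ℤ.- (a ℤ.- b) ≡ ℤ.- a ℤ.- (ℤ.- b)
      eq = solve-∀

  ℤ/ : CommutativeRing 0ℓ 0ℓ
  ℤ/ = record
    { Carrier = ℤ ; _≈_ = _≈_ ; _+_ = ℤ._+_ ; _*_ = ℤ._*_ ; -_ = ℤ.-_ ; 0# = 0ℤ ; 1# = 1ℤ
    ; isCommutativeRing = record
      { isRing = record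
        { +-isAbelianGroup = record
          { isGroup = record
            { isMonoid = record
              { isSemigroup = record
                { isMagma = record
                  { isEquivalence = record { refl = ≡⇒≈ refl ; sym = ≈-sym ; trans = ≈-trans }
                  ; ∙-cong = +-cong }
                ; assoc = λ x y z → ≡⇒≈ (ℤ.+-assoc x y z) }
              ; identity = (λ x → ≡⇒≈ (ℤ.+-identityˡ x)) , (λ x → ≡⇒≈ (ℤ.+-identityʳ x)) }
            ; inverse = (λ x → ≡⇒≈ (ℤ.+-inverseˡ x)) , (λ x → ≡⇒≈ (ℤ.+-inverseʳ x))
            ; ⁻¹-cong = -‿cong }
          ; comm = λ x y → ≡⇒≈ (ℤ.+-comm x y) }
        ; *-cong = *-cong
        ; *-assoc = λ x y z → ≡⇒≈ (ℤ.*-assoc x y z)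
        ; *-identity = (λ x → ≡⇒≈ (ℤ.*-identityˡ x)) , (λ x → ≡⇒≈ (ℤ.*-identityʳ x))
        ; distrib = (λ x y z → ≡⇒≈ (ℤ.*-distribˡ-+ x y z))
                  , (λ x y z → ≡⇒≈ (ℤ.*-distribʳ-+ x y z)) }
      ; *-comm = λ x y → ≡⇒≈ (ℤ.*-comm x y) } }

-- The quotient ring ∏ R i / ⊕ R i: it has the carrier of the product, and two
-- families are equal when their difference lies in ⊕ R i.

module _ {I : Set} (R : I → CommutativeRing 0ℓ 0ℓ) where

  private
    module R i = CommutativeRing (R i)

  ∏ : Set
  ∏ = ∀ i → R.Carrier i

  ⊕ : ∏ → Set
  ⊕ x = Σ[ S ∈ List I ] (∀ i → i ∉ S → R._≈_ i (x i) (R.0# i))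

  record EqualMod⊕ (x y : ∏) : Set where
    constructor equalMod⊕
    field difference∈⊕ : ⊕ (λ i → R._-_ i (x i) (y i))

  private
    infix 4 _≈_
    _≈_ : ∏ → ∏ → Set
    _≈_ = EqualMod⊕

  ≈⇒agree : ∀ {x y} → x ≈ y → Σ[ S ∈ List I ] (∀ i → i ∉ S → R._≈_ i (x i) (y i))
  ≈⇒agree {x} {y} (equalMod⊕ (S , h)) = S , λ i i∉S →
    GroupProperties.x∙y⁻¹≈ε⇒x≈y (R.+-group i) (x i) (y i) (h i i∉S)

  agree⇒≈ : ∀ {x y} → Σ[ S ∈ List I ] (∀ i → i ∉ S → R._≈_ i (x i) (y i)) → x ≈ y
  agree⇒≈ {x} {y} (S , h) = equalMod⊕ (S , λ i i∉S →
    GroupProperties.x≈y⇒x∙y⁻¹≈ε (R.+-group i) (h i i∉S))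

  private
    everywhere : ∀ {x y} → (∀ i → R._≈_ i (x i) (y i)) → x ≈ y
    everywhere h = agree⇒≈ ([] , λ i _ → h i)

    lift₁ : ∀ {x y x′ y′} →
            (∀ i → R._≈_ i (x i) (y i) → R._≈_ i (x′ i) (y′ i)) →
            x ≈ y → x′ ≈ y′
    lift₁ f p with ≈⇒agree p
    ... | S , h = agree⇒≈ (S , λ i i∉ → f i (h i i∉))

    lift₂ : ∀ {x y x′ y′ x″ y″} →
            (∀ i → R._≈_ i (x i) (y i) → R._≈_ i (x′ i) (y′ i) → R._≈_ i (x″ i) (y″ i)) →
            x ≈ y → x′ ≈ y′ → x″ ≈ y″
    lift₂ f p q with ≈⇒agree p | ≈⇒agree q
    ... | S , h | T , k = agree⇒≈
      (S ++ T , λ i i∉ → f i (h i (i∉ ∘ ∈-++⁺ˡ)) (k i (i∉ ∘ ∈-++⁺ʳ S)))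

  ∏/⊕ : CommutativeRing 0ℓ 0ℓ
  ∏/⊕ = record
    { Carrier = ∏
    ; _≈_ = _≈_
    ; _+_ = λ x y i → R._+_ i (x i) (y i)
    ; _*_ = λ x y i → R._*_ i (x i) (y i)
    ; -_ = λ x i → R.-_ i (x i)
    ; 0# = R.0#
    ; 1# = R.1#
    ; isCommutativeRing = record
      { isRing = record
        { +-isAbelianGroup = record
          { isGroup = record
            { isMonoid = record
              { isSemigroup = record
                { isMagma = record
                  { isEquivalence = record
                    { refl = everywhere λ i → R.refl i ; sym = lift₁ λ i → R.sym i ; trans = lift₂ λ i → R.trans i }
                  ; ∙-cong = lift₂ λ i → R.+-cong i }
                ; assoc = λ x y z → everywhere λ i → R.+-assoc i (x i) (y i) (z i) }
              ; identity = (λ x → everywhere λ i → R.+-identityˡ i (x i))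
                         , (λ x → everywhere λ i → R.+-identityʳ i (x i)) }
            ; inverse = (λ x → everywhere λ i → R.-‿inverseˡ i (x i))
                      , (λ x → everywhere λ i → R.-‿inverseʳ i (x i))
            ; ⁻¹-cong = lift₁ λ i → R.-‿cong i }
          ; comm = λ x y → everywhere λ i → R.+-comm i (x i) (y i) }
        ; *-cong = lift₂ λ i → R.*-cong i
        ; *-assoc = λ x y z → everywhere λ i → R.*-assoc i (x i) (y i) (z i)
        ; *-identity = (λ x → everywhere λ i → R.*-identityˡ i (x i))
                     , (λ x → everywhere λ i → R.*-identityʳ i (x i))
        ; distrib = (λ x y z → everywhere λ i → R.distribˡ i (x i) (y i) (z i))
                  , (λ x y z → everywhere λ i → R.distribʳ i (x i) (y i) (z i)) }
      ; *-comm = λ x y → everywhere λ i → R.*-comm i (x i) (y i) } }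

𝔽 : ℙ → CommutativeRing 0ℓ 0ℓ
𝔽 p = ℤ/ (value p)

𝒜 : CommutativeRing 0ℓ 0ℓ
𝒜 = ∏/⊕ 𝔽

module 𝒜 = CommutativeRing 𝒜

-- Reduction modulo p and passage to the class are both the identity on
-- representatives, because only the equality of 𝒜 performs the quotients.

image : (ℙ → ℤ) → 𝒜.Carrier
image a p = a p

const : ℤ → 𝒜.Carrier
const a = image (λ _ → a)

-- A Bézout coefficient: n times it is congruent to gcd m n modulo m, so it
-- represents the inverse of n modulo m whenever n is coprime to m.

inverseMod : (m n : ℕ) → ℤ
inverseMod m n with Bézout.identity (gcd-GCD m n)
... | Bézout.+- x y _ = ℤ.- (+ y)
... | Bézout.-+ x y _ = + y

recip : ℕ → 𝒜.Carrier
recip n = image (λ p → inverseMod (value p) n)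

-- The structure map of the ℚ-algebra 𝒜; it is shown to be a ring homomorphism
-- below.  Its components at the finitely many primes dividing the denominator
-- are irrelevant.

ι : ℚ → 𝒜.Carrier
ι q = const (↥ q) 𝒜.* recip (↧ₙ q)

-- Polynomials as lists of coefficients, constant term first; trailing zeros
-- are allowed, so the zero polynomial is any list of zeros.

ℚ[x] : Set
ℚ[x] = List ℚ

NonZeroPoly : ℚ[x] → Set
NonZeroPoly g = Any (_≢ 0ℚ) g

eval : ℚ[x] → 𝒜.Carrier → 𝒜.Carrier
eval g α = foldr (λ c r → ι c 𝒜.+ α 𝒜.* r) 𝒜.0# g

Algebraic : 𝒜.Carrier → Set
Algebraic α = Σ[ g ∈ ℚ[x] ] (NonZeroPoly g × eval g α 𝒜.≈ 𝒜.0#)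

Transcendental : 𝒜.Carrier → Set
Transcendental α = ¬ Algebraic α

oddDivisors : ℕ → List ℕ
oddDivisors m = filter (λ d → d ∣? m ×-dec ¬? (2 ∣? d)) (upTo (suc m))

-- The default value 1 is itself an odd divisor.

greatestOddDivisor : ℕ → ℕ
greatestOddDivisor m = max 1 (oddDivisors m)

k : ℙ → ℕ
k p = greatestOddDivisor (value p ℕ.∸ 1)

greatestOddDivisor-isOddDivisor : ∀ m → greatestOddDivisor m ∣ m × 2 ∤ greatestOddDivisor m
greatestOddDivisor-isOddDivisor m = argmax-all (λ d → d)
  (1∣ m , λ 2∣1 → contradiction (∣1⇒≡1 2∣1) λ ())
  (all-filter (λ d → d ∣? m ×-dec ¬? (2 ∣? d)) (upTo (suc m)))

greatestOddDivisor-greatest : ∀ m → .{{NonZero m}} → ∀ d → d ∣ m → 2 ∤ d →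
                              d ≤ greatestOddDivisor m
greatestOddDivisor-greatest m d d∣m 2∤d = All.lookup (xs≤max 1 (oddDivisors m))
  (∈-filter⁺ (λ d → d ∣? m ×-dec ¬? (2 ∣? d)) (∈-upTo⁺ (s≤s (∣⇒≤ d∣m))) (d∣m , 2∤d))

private
  primesUpTo : ℕ → List ℙ
  primesUpTo zero = []
  primesUpTo (suc n) with prime? (suc n)
  ... | yes pr = (suc n , [ pr ]) ∷ primesUpTo n
  ... | no  _  = primesUpTo n

  ∈-primesUpTo : ∀ n (p : ℙ) → .{{NonZero (value p)}} → value p ≤ n → p ∈ primesUpTo n
  ∈-primesUpTo zero    (zero  , _) {{()}} z≤n
  ∈-primesUpTo (suc n) p@(m , [ m-prime ]) m≤ with prime? (suc n) | m ℕ.≟ suc n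
  ... | yes pr | yes refl = here refl
  ... | no ¬pr | yes refl = contradiction (recompute (prime? m) m-prime) ¬pr
  ... | yes pr | no  m≢   = there (∈-primesUpTo n p (ℕ.≤-pred (ℕ.≤∧≢⇒< m≤ m≢)))
  ... | no ¬pr | no  m≢   = ∈-primesUpTo n p (ℕ.≤-pred (ℕ.≤∧≢⇒< m≤ m≢))

inverseMod-gcd : ∀ m n → + n ℤ.* inverseMod m n ≡ + gcd m n [mod m ]
inverseMod-gcd m n with Bézout.identity (gcd-GCD m n)
... | Bézout.+- x y eq = congruent (ℤ.divides (ℤ.- (+ x)) (begin
    + n ℤ.* ℤ.- (+ y) ℤ.- + gcd m n      ≡⟨ lem₁ (+ n) (+ y) (+ gcd m n) ⟩
    ℤ.- (+ gcd m n ℤ.+ + y ℤ.* + n)      ≡⟨ cong (λ z → ℤ.- (+ gcd m n ℤ.+ z)) (ℤ.pos-* y n) ⟨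
    ℤ.- (+ (gcd m n ℕ.+ y ℕ.* n))        ≡⟨ cong (λ z → ℤ.- (+ z)) eq ⟩
    ℤ.- (+ (x ℕ.* m))                    ≡⟨ cong ℤ.-_ (ℤ.pos-* x m) ⟩
    ℤ.- (+ x ℤ.* + m)                    ≡⟨ ℤ.neg-distribˡ-* (+ x) (+ m) ⟩
    ℤ.- (+ x) ℤ.* + m                    ∎))
  where
  open ≡.≡-Reasoning
  lem₁ : ∀ n y g → n ℤ.* ℤ.- y ℤ.- g ≡ ℤ.- (g ℤ.+ y ℤ.* n)
  lem₁ = solve-∀
... | Bézout.-+ x y eq = congruent (ℤ.divides (+ x) (begin
    + n ℤ.* + y ℤ.- + gcd m n                    ≡⟨ cong (ℤ._- + gcd m n) (ℤ.*-comm (+ n) (+ y)) ⟩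
    + y ℤ.* + n ℤ.- + gcd m n                    ≡⟨ cong (ℤ._- + gcd m n) (ℤ.pos-* y n) ⟨
    + (y ℕ.* n) ℤ.- + gcd m n                    ≡⟨ cong (λ z → + z ℤ.- + gcd m n) eq ⟨
    + gcd m n ℤ.+ + (x ℕ.* m) ℤ.- + gcd m n      ≡⟨ lem₂ (+ gcd m n) (+ (x ℕ.* m)) ⟩
    + (x ℕ.* m)                                  ≡⟨ ℤ.pos-* x m ⟩
    + x ℤ.* + m                                  ∎))
  where
  open ≡.≡-Reasoning
  lem₂ : ∀ g z → g ℤ.+ z ℤ.- g ≡ z
  lem₂ = solve-∀

recip-inverse : ∀ n → .{{NonZero n}} → const (+ n) 𝒜.* recip n 𝒜.≈ 𝒜.1#
recip-inverse n = agree⇒≈ 𝔽 (primesUpTo n , λ p p∉ →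
  subst (λ g → + n ℤ.* inverseMod (value p) n ≡ + g [mod value p ])
        (coprime⇒gcd≡1 (coprime p p∉)) (inverseMod-gcd (value p) n))
  where
  coprime : ∀ p → p ∉ primesUpTo n → Coprime (value p) n
  coprime p@(m , [ m-prime ]) p∉ = prime⇒coprime pr (ℕ.≰⇒> (p∉ ∘ ∈-primesUpTo n p {{prime⇒nonZero pr}}))
    where pr = recompute (prime? m) m-prime

const-isRingHomomorphism : IsRingHomomorphism ℤ.+-*-rawRing 𝒜.rawRing const
const-isRingHomomorphism = record
  { isSemiringHomomorphism = record
    { isNearSemiringHomomorphism = record
      { +-isMonoidHomomorphism = record
        { isMagmaHomomorphism = record
          { isRelHomomorphism = record { cong = λ { refl → 𝒜.refl } }
          ; homo = λ a b → 𝒜.refl }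
        ; ε-homo = 𝒜.refl }
      ; *-homo = λ a b → 𝒜.refl }
    ; 1#-homo = 𝒜.refl }
  ; -‿homo = λ a → 𝒜.refl }

private
  module Fractions
    (R : CommutativeRing 0ℓ 0ℓ)
    (c : ℤ → CommutativeRing.Carrier R)
    (c-hom : IsRingHomomorphism ℤ.+-*-rawRing (CommutativeRing.rawRing R) c)
    (r : ℕ → CommutativeRing.Carrier R)
    (cr≈1 : ∀ n → .{{NonZero n}} → CommutativeRing._≈_ R
              (CommutativeRing._*_ R (c (+ n)) (r n)) (CommutativeRing.1# R))
    where

    open CommutativeRing R renaming (refl to ≈-refl; trans to ≈-trans)
    open IsRingHomomorphism c-hom using (⟦⟧-cong; +-homo; *-homo; -‿homo; 0#-homo; 1#-homo)
    open import Relation.Binary.Reasoning.Setoid setoid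
    open SemiringSolver commutativeSemiring using (solve; _:=_; _:+_; _:*_)

    f : ℚᵘ → Carrier
    f q = c (ℚᵘ.↥ q) * r (ℚᵘ.↧ₙ q)

    -- f q is the unique solution of den q * x = num q
    f-spec : ∀ q → c (ℚᵘ.↧ q) * f q ≈ c (ℚᵘ.↥ q)
    f-spec q = begin
      d * (n * s)  ≈⟨ solve 3 (λ d n s → d :* (n :* s) := (d :* s) :* n) ≈-refl d n s ⟩
      (d * s) * n  ≈⟨ *-congʳ (cr≈1 (ℚᵘ.↧ₙ q)) ⟩
      1# * n       ≈⟨ *-identityˡ n ⟩
      n            ∎
      where
      d = c (ℚᵘ.↧ q) ; n = c (ℚᵘ.↥ q) ; s = r (ℚᵘ.↧ₙ q)

    cancel : ∀ m → .{{NonZero m}} → ∀ x y → c (+ m) * x ≈ c (+ m) * y → x ≈ y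
    cancel m x y eq = begin
      x                    ≈⟨ expand x ⟨
      r m * (c (+ m) * x)  ≈⟨ *-congˡ eq ⟩
      r m * (c (+ m) * y)  ≈⟨ expand y ⟩
      y                    ∎
      where
      expand : ∀ x → r m * (c (+ m) * x) ≈ x
      expand x = begin
        r m * (c (+ m) * x)  ≈⟨ *-assoc (r m) (c (+ m)) x ⟨
        (r m * c (+ m)) * x  ≈⟨ *-congʳ (*-comm (r m) (c (+ m))) ⟩
        (c (+ m) * r m) * x  ≈⟨ *-congʳ (cr≈1 m) ⟩
        1# * x               ≈⟨ *-identityˡ x ⟩
        x                    ∎

    f-unique : ∀ q x → c (ℚᵘ.↧ q) * x ≈ c (ℚᵘ.↥ q) → f q ≈ x
    f-unique q x h = cancel (ℚᵘ.↧ₙ q) (f q) x (≈-trans (f-spec q) (sym h))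

    f-cong : ∀ {q q′} → q ℚᵘ.≃ q′ → f q ≈ f q′
    f-cong {q} {q′} (*≡* eq) = f-unique q (f q′) (cancel (ℚᵘ.↧ₙ q′) _ _ (begin
      d′ * (d * f q′)         ≈⟨ solve 3 (λ d′ d y → d′ :* (d :* y) := (d′ :* y) :* d) (≈-refl) d′ d (f q′) ⟩
      (d′ * f q′) * d         ≈⟨ *-congʳ (f-spec q′) ⟩
      c (ℚᵘ.↥ q′) * d         ≈⟨ *-homo (ℚᵘ.↥ q′) (ℚᵘ.↧ q) ⟨
      c (ℚᵘ.↥ q′ ℤ.* ℚᵘ.↧ q)  ≈⟨ ⟦⟧-cong eq ⟨
      c (ℚᵘ.↥ q ℤ.* ℚᵘ.↧ q′)  ≈⟨ *-homo (ℚᵘ.↥ q) (ℚᵘ.↧ q′) ⟩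
      c (ℚᵘ.↥ q) * d′         ≈⟨ *-comm (c (ℚᵘ.↥ q)) d′ ⟩
      d′ * c (ℚᵘ.↥ q)         ∎))
      where d = c (ℚᵘ.↧ q) ; d′ = c (ℚᵘ.↧ q′)

    f-+ : ∀ q q′ → f (q ℚᵘ.+ q′) ≈ f q + f q′
    f-+ q@record{} q′@record{} = f-unique (q ℚᵘ.+ q′) (f q + f q′) (begin
      c (ℚᵘ.↧ (q ℚᵘ.+ q′)) * (f q + f q′)  ≈⟨ *-congʳ (*-homo (ℚᵘ.↧ q) (ℚᵘ.↧ q′)) ⟩
      (d * d′) * (f q + f q′)
        ≈⟨ solve 4 (λ d d′ x y → (d :* d′) :* (x :+ y) := ((d :* x) :* d′) :+ ((d′ :* y) :* d))
             (≈-refl) d d′ (f q) (f q′) ⟩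
      (d * f q) * d′ + (d′ * f q′) * d     ≈⟨ +-cong (*-congʳ (f-spec q)) (*-congʳ (f-spec q′)) ⟩
      c (ℚᵘ.↥ q) * d′ + c (ℚᵘ.↥ q′) * d
        ≈⟨ +-cong (*-homo (ℚᵘ.↥ q) (ℚᵘ.↧ q′)) (*-homo (ℚᵘ.↥ q′) (ℚᵘ.↧ q)) ⟨
      c (ℚᵘ.↥ q ℤ.* ℚᵘ.↧ q′) + c (ℚᵘ.↥ q′ ℤ.* ℚᵘ.↧ q)  ≈⟨ +-homo _ _ ⟨
      c (ℚᵘ.↥ (q ℚᵘ.+ q′))                 ∎)
      where d = c (ℚᵘ.↧ q) ; d′ = c (ℚᵘ.↧ q′)

    f-* : ∀ q q′ → f (q ℚᵘ.* q′) ≈ f q * f q′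
    f-* q@record{} q′@record{} = f-unique (q ℚᵘ.* q′) (f q * f q′) (begin
      c (ℚᵘ.↧ (q ℚᵘ.* q′)) * (f q * f q′)  ≈⟨ *-congʳ (*-homo (ℚᵘ.↧ q) (ℚᵘ.↧ q′)) ⟩
      (d * d′) * (f q * f q′)
        ≈⟨ solve 4 (λ d d′ x y → (d :* d′) :* (x :* y) := (d :* x) :* (d′ :* y))
             (≈-refl) d d′ (f q) (f q′) ⟩
      (d * f q) * (d′ * f q′)              ≈⟨ *-cong (f-spec q) (f-spec q′) ⟩
      c (ℚᵘ.↥ q) * c (ℚᵘ.↥ q′)             ≈⟨ *-homo (ℚᵘ.↥ q) (ℚᵘ.↥ q′) ⟨
      c (ℚᵘ.↥ (q ℚᵘ.* q′))                 ∎)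
      where d = c (ℚᵘ.↧ q) ; d′ = c (ℚᵘ.↧ q′)

    f-neg : ∀ q → f (ℚᵘ.- q) ≈ - f q
    f-neg q@record{} = f-unique (ℚᵘ.- q) (- f q) (begin
      c (ℚᵘ.↧ q) * (- f q)    ≈⟨ RingProperties.-‿distribʳ-* ring (c (ℚᵘ.↧ q)) (f q) ⟨
      - (c (ℚᵘ.↧ q) * f q)    ≈⟨ -‿cong (f-spec q) ⟩
      - c (ℚᵘ.↥ q)            ≈⟨ -‿homo (ℚᵘ.↥ q) ⟨
      c (ℚᵘ.↥ (ℚᵘ.- q))       ∎)

    f∘toℚᵘ-isRingHomomorphism : IsRingHomomorphism ℚ.+-*-rawRing rawRing (λ q → c (↥ q) * r (↧ₙ q))
    f∘toℚᵘ-isRingHomomorphism = record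
      { isSemiringHomomorphism = record
        { isNearSemiringHomomorphism = record
          { +-isMonoidHomomorphism = record
            { isMagmaHomomorphism = record
              { isRelHomomorphism = record { cong = λ { ≡.refl → ≈-refl } }
              ; homo = λ p q → ≈-trans (at (p ℚ.+ q))
                  (≈-trans (f-cong (ℚ.toℚᵘ-homo-+ p q))
                  (≈-trans (f-+ (toℚᵘ p) (toℚᵘ q)) (sym (+-cong (at p) (at q))))) }
            ; ε-homo = f-unique ℚᵘ.0ℚᵘ 0# (≈-trans (zeroʳ _) (sym 0#-homo)) }
          ; *-homo = λ p q → ≈-trans (at (p ℚ.* q))
              (≈-trans (f-cong (ℚ.toℚᵘ-homo-* p q))
              (≈-trans (f-* (toℚᵘ p) (toℚᵘ q)) (sym (*-cong (at p) (at q))))) }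
        ; 1#-homo = f-unique ℚᵘ.1ℚᵘ 1# (*-identityʳ _) }
      ; -‿homo = λ p → ≈-trans (at (ℚ.- p))
          (≈-trans (f-cong (ℚ.toℚᵘ-homo‿- p))
          (≈-trans (f-neg (toℚᵘ p)) (sym (-‿cong (at p))))) }
      where
      at : ∀ q → c (↥ q) * r (↧ₙ q) ≈ f (toℚᵘ q)
      at q@record{} = ≈-refl

ι-isRingHomomorphism : IsRingHomomorphism ℚ.+-*-rawRing 𝒜.rawRing ι
ι-isRingHomomorphism = Fractions.f∘toℚᵘ-isRingHomomorphism
  𝒜 const const-isRingHomomorphism recip (λ n → recip-inverse n)

{-# OPTIONS --safe #-}

-- Let |n| > 1, write k for k_p and α = n^((k + 1)/2), so that α⁴ = (n²)^(k + 1),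
-- and suppose that a nonzero polynomial kills α modulo almost all p.
-- After clearing denominators and dividing by a power of x it is an integral l
-- with l(0) ≠ 0.  Two Graeffe root-squarings produce g with g(α⁴) = 0 and
-- g(0) ≠ 0.  The polynomials x^2ˢ + (n²)^2ˢ are pairwise coprime, so one of them
-- is coprime to g: if -n² is a root of g, divide by x + n², square the roots and
-- start again with n⁴ and a smaller degree.  For that s put X = (n²)^2ˢ.  Primes
-- dividing M² - M + 1, M = X^3ⁱ, are pairwise distinct, and X^3ⁱ⁺¹ = -1 modulo
-- them.  As p - 1 is k times a power of 2, comparing an odd order with a power of
-- 2 gives X^k = -1, whence (α⁴)^2ˢ = X^(k + 1) = -(n²)^2ˢ modulo infinitely many
-- p: contradiction.  If |n| ≤ 1, then α³ = α.

module Submission where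

open import Defs
open import Algebra.Bundles using (CommutativeRing)
import Algebra.Properties.CommutativeSemiring.Binomial as Binomial
import Algebra.Properties.Group as GroupProperties
import Algebra.Properties.Monoid.Mult as Mult
import Algebra.Properties.Monoid.Sum as Sum
import Algebra.Properties.Semiring.Exp as Exp
open import Data.Fin.Base as Fin using (Fin; zero; suc; toℕ; inject₁; fromℕ<)
open import Data.Fin.Properties using (toℕ<n; toℕ-inject₁; toℕ-fromℕ; toℕ-fromℕ<; any?; pigeonhole)
open import Data.Integer.Base as ℤ using (ℤ; +_; 0ℤ; 1ℤ; -1ℤ; ∣_∣; _^_)
import Data.Integer.DivMod as ℤ
import Data.Integer.Divisibility.Signed as ℤ
import Data.Integer.Properties as ℤ
open import Data.Integer.Tactic.RingSolver using (solve-∀)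
open import Data.Irrelevant using ([_])
open import Data.List.Base using (List; []; _∷_; _++_; foldr; length; map)
open import Data.List.Extrema.Nat using (max; xs≤max)
open import Data.List.Membership.Propositional using (_∉_)
open import Data.List.Membership.Propositional.Properties using (∈-++⁺ˡ; ∈-++⁺ʳ; ∈-map⁺)
open import Data.List.Properties using (length-map)
open import Data.List.Relation.Unary.All as All using ()
open import Data.List.Relation.Unary.Any using (Any; here; there)
open import Data.Nat.Base as ℕ using (ℕ; zero; suc; s≤s; z≤n; _+_; _*_; _∸_; _!; _/_; _<_; _≤_; _>_)
open import Data.Nat.Combinatorics using (_C_; nCn≡1; nCk≡n!/k![n-k]!; k![n∸k]!∣n!)
open import Data.Nat.Coprimality using (Coprime; coprime-divisor)
open import Data.Nat.DivMod using (m*n/n≡m)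
open import Data.Nat.Divisibility
  using (_∣_; _∤_; divides; ∣⇒≤; >⇒∤; ∣1⇒≡1; m∣m*n; n/m≡quotient; ∣m+n∣m⇒∣n)
open import Data.Nat.Induction using (<-rec)
open import Data.Nat.Primality
  using (Prime; prime?; euclidsLemma; prime⇒nonZero; prime⇒nonTrivial; prime⇒irreducible; irreducible[2])
open import Data.Nat.Primality.Factorisation using (factorise)
import Data.Nat.Properties as ℕ
import Data.Nat.Tactic.RingSolver as ℕ
open import Data.Product.Base using (_×_; _,_; Σ-syntax; ∃-syntax; proj₁; proj₂)
open import Data.Rational.Base as ℚ using (0ℚ; 1ℚ; ↥_; ↧_; ↧ₙ_)
import Data.Rational.Properties as ℚ
open import Data.Refinement using (_,_; value)
open import Data.Sum.Base using (_⊎_; inj₁; inj₂; [_,_]′)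
open import Function.Base using (_∘_)
open import Function.Bundles using (_⇔_; mk⇔)
open import Relation.Binary.PropositionalEquality as ≡ using (_≡_; _≢_; refl; cong; cong₂; subst)
open import Relation.Nullary using (¬_; yes; no; contradiction)
open import Relation.Nullary.Decidable using (from-yes; decidable-stable)

-- Congruences of integers and prime moduli.

module Mod (p : ℕ) where
  open CommutativeRing (ℤ/ p) public
    using (_≈_; setoid; reflexive; +-cong; +-congʳ; +-congˡ; *-cong; *-congʳ; *-congˡ; -‿cong;
           semiring; commutativeSemiring; +-monoid; +-group)
    renaming (refl to ≈-refl; sym to ≈-sym; trans to ≈-trans)
  open import Relation.Binary.Reasoning.Setoid setoid public

^-cong : ∀ {p a b} n → a ≡ b [mod p ] → a ^ n ≡ b ^ n [mod p ]
^-cong {p} zero    a≡b = Mod.≈-refl p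
^-cong {p} (suc n) a≡b = Mod.*-cong p a≡b (^-cong n a≡b)

≡0⇒∣ : ∀ {p a} → a ≡ 0ℤ [mod p ] → p ∣ ∣ a ∣
≡0⇒∣ {p} {a} (congruent p∣a-0) = ℤ.∣⇒∣ᵤ (subst (+ p ℤ.∣_) (ℤ.+-identityʳ a) p∣a-0)

∣⇒≡0 : ∀ {p a} → p ∣ ∣ a ∣ → a ≡ 0ℤ [mod p ]
∣⇒≡0 {p} {a} p∣a = congruent (subst (+ p ℤ.∣_) (≡.sym (ℤ.+-identityʳ a)) (ℤ.∣ᵤ⇒∣ p∣a))

*≡0 : ∀ {p} → Prime p → ∀ a b → a ℤ.* b ≡ 0ℤ [mod p ] → a ≡ 0ℤ [mod p ] ⊎ b ≡ 0ℤ [mod p ]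
*≡0 {p} p-prime a b ab≡0
  with euclidsLemma ∣ a ∣ ∣ b ∣ p-prime (subst (p ∣_) (ℤ.abs-* a b) (≡0⇒∣ ab≡0))
... | inj₁ p∣a = inj₁ (∣⇒≡0 p∣a)
... | inj₂ p∣b = inj₂ (∣⇒≡0 p∣b)

^≡0 : ∀ {p} → Prime p → ∀ a n → a ^ n ≡ 0ℤ [mod p ] → a ≡ 0ℤ [mod p ]
^≡0 p-prime a zero 1≡0 =
  contradiction (∣1⇒≡1 (≡0⇒∣ 1≡0)) (ℕ.nonTrivial⇒≢1 {{prime⇒nonTrivial p-prime}})
^≡0 p-prime a (suc n) a^[1+n]≡0 with *≡0 p-prime a (a ^ n) a^[1+n]≡0
... | inj₁ a≡0   = a≡0
... | inj₂ a^n≡0 = ^≡0 p-prime a n a^n≡0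

-≡0⇒≡ : ∀ {p} a b → a ℤ.- b ≡ 0ℤ [mod p ] → a ≡ b [mod p ]
-≡0⇒≡ {p} = GroupProperties.x∙y⁻¹≈ε⇒x≈y (Mod.+-group p)

≡-remainder : ∀ a d → .{{_ : ℕ.NonZero d}} → a ≡ + (a ℤ.%ℕ d) [mod d ]
≡-remainder a d = congruent (ℤ.divides (a ℤ./ℕ d)
  (≡.trans (cong (ℤ._- + (a ℤ.%ℕ d)) (ℤ.a≡a%ℕn+[a/ℕn]*n a d)) (eq (+ (a ℤ.%ℕ d)) (a ℤ./ℕ d ℤ.* + d))))
  where
  eq : ∀ r s → r ℤ.+ s ℤ.- r ≡ s
  eq = solve-∀

-- Fermat's little theorem

prime∤! : ∀ {p} → Prime p → ∀ k → k < p → p ∤ k !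
prime∤! p-prime zero    _   p∣1 = ℕ.nonTrivial⇒≢1 {{prime⇒nonTrivial p-prime}} (∣1⇒≡1 p∣1)
prime∤! p-prime (suc k) k<p p∣[k+1]! with euclidsLemma (suc k) (k !) p-prime p∣[k+1]!
... | inj₁ p∣k+1 = ℕ.<⇒≱ k<p (∣⇒≤ p∣k+1)
... | inj₂ p∣k!  = prime∤! p-prime k (ℕ.<-trans (ℕ.n<1+n k) k<p) p∣k!

-- The prime divides p! = q * (k! * (p - k)!), where q is the binomial coefficient, but neither
-- factorial, as all their factors are smaller than p.
prime∣C : ∀ {p k} → Prime p → 0 < k → k < p → p ∣ p C k
prime∣C {p} {k} p-prime 0<k k<p with k![n∸k]!∣n! (ℕ.<⇒≤ k<p)
... | k![p-k]!∣p!@(divides q p!≡qd) = subst (p ∣_) (≡.sym pCk≡q) p∣q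
  where
  instance d≢0 = k ℕ.!* (p ∸ k) !≢0
  pCk≡q : p C k ≡ q
  pCk≡q = ≡.trans (nCk≡n!/k![n-k]! (ℕ.<⇒≤ k<p)) (n/m≡quotient k![p-k]!∣p!)
  p∣p! : ∀ p → .{{ℕ.NonZero p}} → p ∣ p !
  p∣p! (suc p) = m∣m*n (p !)
  p∣q : p ∣ q
  p∣q with euclidsLemma q _ p-prime (subst (p ∣_) p!≡qd (p∣p! p {{prime⇒nonZero p-prime}}))
  ... | inj₁ p∣q = p∣q
  ... | inj₂ p∣d with euclidsLemma (k !) ((p ∸ k) !) p-prime p∣d
  ...   | inj₁ p∣k! = contradiction p∣k! (prime∤! p-prime k k<p)
  ...   | inj₂ p∣[p-k]! = contradiction p∣[p-k]!
          (prime∤! p-prime (p ∸ k) (ℕ.∸-monoʳ-< 0<k (ℕ.<⇒≤ k<p)))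

module _ {p : ℕ} (p-prime : Prime p) where
  open Mod p
  private
    module M = Mult +-monoid
    module S = Sum +-monoid
    module B = Binomial commutativeSemiring
    module E = Exp semiring

    ×≡* : ∀ n x → n M.× x ≡ + n ℤ.* x
    ×≡* zero    x = refl
    ×≡* (suc n) x = ≡.trans (cong (λ y → x ℤ.+ y) (×≡* n x)) (≡.sym (ℤ.suc-* (+ n) x))

    ^≡^ : ∀ x n → x E.^ n ≡ x ^ n
    ^≡^ x zero    = refl
    ^≡^ x (suc n) = cong (x ℤ.*_) (^≡^ x n)

    +p≡0 : ∀ {m} x → p ∣ m → m M.× x ≈ 0ℤ
    +p≡0 {m} x p∣m = begin
      m M.× x    ≡⟨ ×≡* m x ⟩
      + m ℤ.* x  ≈⟨ *-congʳ {x} {+ m} {0ℤ} (∣⇒≡0 p∣m) ⟩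
      0ℤ         ∎

  -- By `prime∣C` only the two end terms of the binomial expansion survive. This is the induction
  -- step of `fermat-ℕ`.
  freshman : ∀ x → (x ℤ.+ 1ℤ) ^ p ≡ x ^ p ℤ.+ 1ℤ [mod p ]
  freshman x = expand p refl (prime⇒nonZero p-prime)
    where
    -- The exponent is kept variable so that matching on `suc m` exposes the first and last terms;
    -- `n≡p` brings the prime back for the middle ones.
    expand : ∀ n → n ≡ p → ℕ.NonZero n → (x ℤ.+ 1ℤ) ^ n ≈ x ^ n ℤ.+ 1ℤ
    expand (suc m) n≡p _ = begin
      (x ℤ.+ 1ℤ) ^ n                 ≡⟨ ^≡^ (x ℤ.+ 1ℤ) n ⟨
      (x ℤ.+ 1ℤ) E.^ n               ≈⟨ B.theorem n x 1ℤ ⟩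
      t zero ℤ.+ S.sum (t ∘ suc)     ≈⟨ +-cong t₀ (S.sum-init-last (t ∘ suc)) ⟩
      1ℤ ℤ.+ (S.sum (t ∘ suc ∘ inject₁) ℤ.+ t (suc (Fin.fromℕ m)))
        ≈⟨ +-congˡ {1ℤ} (+-cong (≈-trans (S.sum-cong-≋ middle) (S.sum-replicate-zero m)) tₙ) ⟩
      1ℤ ℤ.+ (0ℤ ℤ.+ x ^ n)          ≡⟨ eq (x ^ n) ⟩
      x ^ n ℤ.+ 1ℤ                   ∎
      where
      n = suc m
      t = B.binomialTerm x 1ℤ n
      one^ : ∀ k → 1ℤ E.^ k ≡ 1ℤ
      one^ k = ≡.trans (^≡^ 1ℤ k) (ℤ.^-zeroˡ k)
      eq : ∀ y → 1ℤ ℤ.+ (0ℤ ℤ.+ y) ≡ y ℤ.+ 1ℤ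
      eq = solve-∀
      t₀ : t zero ≈ 1ℤ
      t₀ = reflexive (≡.trans (×≡* 1 (1ℤ ℤ.* 1ℤ E.^ n))
        (≡.trans (ℤ.*-identityˡ (1ℤ ℤ.* 1ℤ E.^ n)) (≡.trans (ℤ.*-identityˡ (1ℤ E.^ n)) (one^ n))))
      middle : ∀ i → t (suc (inject₁ i)) ≈ 0ℤ
      middle i = +p≡0 _ (subst (λ q → p ∣ q C suc (toℕ (inject₁ i))) (≡.sym n≡p)
        (prime∣C p-prime (s≤s z≤n) (subst (suc (toℕ (inject₁ i)) <_) n≡p
          (s≤s (subst (_< m) (≡.sym (toℕ-inject₁ i)) (toℕ<n i))))))
      tₙ : t (suc (Fin.fromℕ m)) ≈ x ^ n
      tₙ rewrite toℕ-fromℕ m | nCn≡1 n | ℕ.n∸n≡0 m = reflexive (≡.trans (×≡* 1 (x E.^ n ℤ.* 1ℤ))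
        (≡.trans (ℤ.*-identityˡ (x E.^ n ℤ.* 1ℤ)) (≡.trans (ℤ.*-identityʳ (x E.^ n)) (^≡^ x n))))

  fermat-ℕ : ∀ a → (+ a) ^ p ≡ + a [mod p ]
  fermat-ℕ zero = reflexive (zero^ p (prime⇒nonZero p-prime))
    where
    zero^ : ∀ n → ℕ.NonZero n → 0ℤ ^ n ≡ 0ℤ
    zero^ (suc n) _ = refl
  fermat-ℕ (suc a) = begin
    (+ suc a) ^ p          ≡⟨ cong (_^ p) (ℤ.+-comm 1ℤ (+ a)) ⟩
    (+ a ℤ.+ 1ℤ) ^ p       ≈⟨ freshman (+ a) ⟩
    (+ a) ^ p ℤ.+ 1ℤ       ≈⟨ +-congʳ (fermat-ℕ a) ⟩
    + a ℤ.+ 1ℤ             ≡⟨ ℤ.+-comm (+ a) 1ℤ ⟩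
    + suc a                ∎

  fermat : ∀ a → a ^ p ≡ a [mod p ]
  fermat a = begin
    a ^ p        ≈⟨ ^-cong p a≡r ⟩
    (+ r) ^ p    ≈⟨ fermat-ℕ r ⟩
    + r          ≈⟨ a≡r ⟨
    a            ∎
    where
    instance p≢0 = prime⇒nonZero p-prime
    r = a ℤ.%ℕ p
    a≡r : a ≈ + r
    a≡r = ≡-remainder a p

  -- The factor `a` of `a ^ p - a` is nonzero modulo p, so the other factor vanishes.
  fermat-unit : ∀ a → ¬ a ≡ 0ℤ [mod p ] → a ^ (p ∸ 1) ≡ 1ℤ [mod p ]
  fermat-unit a a≢0 = [ (λ a≡0 → contradiction a≡0 a≢0) , -≡0⇒≡ _ 1ℤ ]′
    (*≡0 p-prime a (a ^ (p ∸ 1) ℤ.- 1ℤ) (begin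
      a ℤ.* (a ^ (p ∸ 1) ℤ.- 1ℤ)   ≡⟨ eq a (a ^ (p ∸ 1)) ⟩
      a ^ suc (p ∸ 1) ℤ.- a        ≡⟨ cong (λ n → a ^ n ℤ.- a) (ℕ.suc-pred p {{prime⇒nonZero p-prime}}) ⟩
      a ^ p ℤ.- a                  ≈⟨ +-congʳ (fermat a) ⟩
      a ℤ.- a                      ≡⟨ ℤ.+-inverseʳ a ⟩
      0ℤ                           ∎))
    where
    eq : ∀ a b → a ℤ.* (b ℤ.- 1ℤ) ≡ a ℤ.* b ℤ.- a
    eq = solve-∀

-- Integer polynomials and root squaring

ℤ[x] : Set
ℤ[x] = List ℤ

⟦_⟧ : ℤ[x] → ℤ → ℤ
⟦ g ⟧ x = foldr (λ c r → c ℤ.+ x ℤ.* r) 0ℤ g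

⟦⟧-cong : ∀ {p a b} g → a ≡ b [mod p ] → ⟦ g ⟧ a ≡ ⟦ g ⟧ b [mod p ]
⟦⟧-cong {p} []      a≡b = Mod.≈-refl p
⟦⟧-cong {p} (c ∷ g) a≡b = Mod.+-congˡ p {c} (Mod.*-cong p a≡b (⟦⟧-cong g a≡b))

-- Synthetic division: the quotient of c ∷ h by x - r, whatever c is.
quotient : ℤ → ℤ[x] → ℤ[x]
quotient r []      = []
quotient r (b ∷ h) = ⟦ b ∷ h ⟧ r ∷ quotient r h

length-quotient : ∀ r h → length (quotient r h) ≡ length h
length-quotient r []      = refl
length-quotient r (b ∷ h) = cong suc (length-quotient r h)

remainder-theorem : ∀ r c h x →
  ⟦ c ∷ h ⟧ x ≡ ⟦ c ∷ h ⟧ r ℤ.+ (x ℤ.- r) ℤ.* ⟦ quotient r h ⟧ x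
remainder-theorem r c []      x = eq c r x
  where
  eq : ∀ c r x → c ℤ.+ x ℤ.* 0ℤ ≡ c ℤ.+ r ℤ.* 0ℤ ℤ.+ (x ℤ.- r) ℤ.* 0ℤ
  eq = solve-∀
remainder-theorem r c (b ∷ h) x =
  ≡.trans (cong (λ y → c ℤ.+ x ℤ.* y) (remainder-theorem r b h x))
          (eq c r x (⟦ b ∷ h ⟧ r) (⟦ quotient r h ⟧ x))
  where
  eq : ∀ c r x y z → c ℤ.+ x ℤ.* (y ℤ.+ (x ℤ.- r) ℤ.* z) ≡
       c ℤ.+ r ℤ.* y ℤ.+ (x ℤ.- r) ℤ.* (y ℤ.+ x ℤ.* z)
  eq = solve-∀

infixl 6 _⊞_
infixl 7 _⊠_

_⊞_ : ℤ[x] → ℤ[x] → ℤ[x]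
[]      ⊞ h       = h
(a ∷ g) ⊞ []      = a ∷ g
(a ∷ g) ⊞ (b ∷ h) = (a ℤ.+ b) ∷ (g ⊞ h)

_⊠_ : ℤ[x] → ℤ[x] → ℤ[x]
[]      ⊠ h = []
(a ∷ g) ⊠ h = map (λ b → a ℤ.* b) h ⊞ (0ℤ ∷ (g ⊠ h))

⊞-homo : ∀ g h x → ⟦ g ⊞ h ⟧ x ≡ ⟦ g ⟧ x ℤ.+ ⟦ h ⟧ x
⊞-homo []      h       x = ≡.sym (ℤ.+-identityˡ _)
⊞-homo (a ∷ g) []      x = ≡.sym (ℤ.+-identityʳ _)
⊞-homo (a ∷ g) (b ∷ h) x =
  ≡.trans (cong (λ y → a ℤ.+ b ℤ.+ x ℤ.* y) (⊞-homo g h x)) (eq a b x (⟦ g ⟧ x) (⟦ h ⟧ x))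
  where
  eq : ∀ a b x y z → a ℤ.+ b ℤ.+ x ℤ.* (y ℤ.+ z) ≡ a ℤ.+ x ℤ.* y ℤ.+ (b ℤ.+ x ℤ.* z)
  eq = solve-∀

map-*-homo : ∀ a g x → ⟦ map (λ b → a ℤ.* b) g ⟧ x ≡ a ℤ.* ⟦ g ⟧ x
map-*-homo a []      x = ≡.sym (ℤ.*-zeroʳ a)
map-*-homo a (b ∷ g) x =
  ≡.trans (cong (λ y → a ℤ.* b ℤ.+ x ℤ.* y) (map-*-homo a g x)) (eq a b x (⟦ g ⟧ x))
  where
  eq : ∀ a b x y → a ℤ.* b ℤ.+ x ℤ.* (a ℤ.* y) ≡ a ℤ.* (b ℤ.+ x ℤ.* y)
  eq = solve-∀

⊠-homo : ∀ g h x → ⟦ g ⊠ h ⟧ x ≡ ⟦ g ⟧ x ℤ.* ⟦ h ⟧ x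
⊠-homo []      h x = refl
⊠-homo (a ∷ g) h x = begin
  ⟦ map (λ b → a ℤ.* b) h ⊞ (0ℤ ∷ (g ⊠ h)) ⟧ x
    ≡⟨ ⊞-homo (map (λ b → a ℤ.* b) h) (0ℤ ∷ (g ⊠ h)) x ⟩
  ⟦ map (λ b → a ℤ.* b) h ⟧ x ℤ.+ (0ℤ ℤ.+ x ℤ.* ⟦ g ⊠ h ⟧ x)
    ≡⟨ cong₂ (λ y z → y ℤ.+ (0ℤ ℤ.+ x ℤ.* z)) (map-*-homo a h x) (⊠-homo g h x) ⟩
  a ℤ.* ⟦ h ⟧ x ℤ.+ (0ℤ ℤ.+ x ℤ.* (⟦ g ⟧ x ℤ.* ⟦ h ⟧ x))
    ≡⟨ eq a x (⟦ g ⟧ x) (⟦ h ⟧ x) ⟩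
  ⟦ a ∷ g ⟧ x ℤ.* ⟦ h ⟧ x ∎
  where
  open ≡.≡-Reasoning
  eq : ∀ a x y z → a ℤ.* z ℤ.+ (0ℤ ℤ.+ x ℤ.* (y ℤ.* z)) ≡ (a ℤ.+ x ℤ.* y) ℤ.* z
  eq = solve-∀

length-⊞ : ∀ {n} g h → length g ≤ n → length h ≤ n → length (g ⊞ h) ≤ n
length-⊞ []      h       g≤n       h≤n       = h≤n
length-⊞ (a ∷ g) []      g≤n       h≤n       = g≤n
length-⊞ (a ∷ g) (b ∷ h) (s≤s g≤n) (s≤s h≤n) = s≤s (length-⊞ g h g≤n h≤n)

-- Length is formal degree plus one, so a product of nonempty lists is one shorter than the sum of
-- the lengths; the second factor is written as `b ∷ h` to avoid subtraction.
length-⊠ : ∀ g b h → length (g ⊠ (b ∷ h)) ≤ length g + length h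
length-⊠ []      b h = z≤n
length-⊠ (a ∷ g) b h = length-⊞ (map (λ b → a ℤ.* b) (b ∷ h)) (0ℤ ∷ (g ⊠ (b ∷ h)))
  (s≤s (ℕ.≤-trans (ℕ.≤-reflexive (length-map _ h)) (ℕ.m≤n+m (length h) (length g))))
  (s≤s (length-⊠ g b h))

even odd : ℤ[x] → ℤ[x]
even []      = []
even (a ∷ g) = a ∷ odd g
odd []      = []
odd (a ∷ g) = even g

even-odd : ∀ g x → ⟦ g ⟧ x ≡ ⟦ even g ⟧ (x ℤ.* x) ℤ.+ x ℤ.* ⟦ odd g ⟧ (x ℤ.* x)
even-odd []      x = ≡.sym (≡.trans (ℤ.+-identityˡ _) (ℤ.*-zeroʳ x))
even-odd (a ∷ g) x =
  ≡.trans (cong (λ y → a ℤ.+ x ℤ.* y) (even-odd g x)) (eq a x (⟦ even g ⟧ (x ℤ.* x)) (⟦ odd g ⟧ (x ℤ.* x)))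
  where
  eq : ∀ a x y z → a ℤ.+ x ℤ.* (y ℤ.+ x ℤ.* z) ≡ a ℤ.+ x ℤ.* x ℤ.* z ℤ.+ x ℤ.* y
  eq = solve-∀

length-even-odd : ∀ g → length (even g) + length (odd g) ≡ length g
length-even-odd []      = refl
length-even-odd (a ∷ g) = cong suc (≡.trans (ℕ.+-comm (length (odd g)) _) (length-even-odd g))

-- Prepending a coefficient exchanges the two halves, hence the mutual induction.
length-odd≤even : ∀ g → length (odd g) ≤ length (even g)
length-even≤1+odd : ∀ g → length (even g) ≤ suc (length (odd g))
length-odd≤even []      = z≤n
length-odd≤even (a ∷ g) = length-even≤1+odd g
length-even≤1+odd []      = z≤n
length-even≤1+odd (a ∷ g) = s≤s (length-odd≤even g)

-- With g(x) = E(x²) + x O(x²), this is E(y)² - y O(y)². At y = x² it equals g(x) g(-x), so squares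
-- of roots of `g` are roots of it.
graeffe : ℤ[x] → ℤ[x]
graeffe g = even g ⊠ even g ⊞ (0ℤ ∷ (map (λ b → -1ℤ ℤ.* b) (odd g ⊠ odd g)))

graeffe-eval : ∀ g y → ⟦ graeffe g ⟧ y ≡
  ⟦ even g ⟧ y ℤ.* ⟦ even g ⟧ y ℤ.- y ℤ.* (⟦ odd g ⟧ y ℤ.* ⟦ odd g ⟧ y)
graeffe-eval g y = begin
  ⟦ graeffe g ⟧ y
    ≡⟨ ⊞-homo (even g ⊠ even g) (0ℤ ∷ (map (λ b → -1ℤ ℤ.* b) (odd g ⊠ odd g))) y ⟩
  ⟦ even g ⊠ even g ⟧ y ℤ.+ (0ℤ ℤ.+ y ℤ.* ⟦ map (λ b → -1ℤ ℤ.* b) (odd g ⊠ odd g) ⟧ y)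
    ≡⟨ cong₂ (λ u v → u ℤ.+ (0ℤ ℤ.+ y ℤ.* v)) (⊠-homo (even g) (even g) y)
         (≡.trans (map-*-homo -1ℤ (odd g ⊠ odd g) y) (cong (λ z → -1ℤ ℤ.* z) (⊠-homo (odd g) (odd g) y))) ⟩
  E ℤ.* E ℤ.+ (0ℤ ℤ.+ y ℤ.* (-1ℤ ℤ.* (O ℤ.* O)))
    ≡⟨ eq y E O ⟩
  E ℤ.* E ℤ.- y ℤ.* (O ℤ.* O) ∎
  where
  open ≡.≡-Reasoning
  E = ⟦ even g ⟧ y
  O = ⟦ odd g ⟧ y
  eq : ∀ y e o → e ℤ.* e ℤ.+ (0ℤ ℤ.+ y ℤ.* (-1ℤ ℤ.* (o ℤ.* o))) ≡ e ℤ.* e ℤ.- y ℤ.* (o ℤ.* o)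
  eq = solve-∀

graeffe-square : ∀ g x → ⟦ graeffe g ⟧ (x ^ 2) ≡ ⟦ g ⟧ x ℤ.* ⟦ g ⟧ (ℤ.- x)
graeffe-square g x = begin
  ⟦ graeffe g ⟧ (x ^ 2)
    ≡⟨ cong (λ y → ⟦ graeffe g ⟧ (x ℤ.* y)) (ℤ.*-identityʳ x) ⟩
  ⟦ graeffe g ⟧ (x ℤ.* x)
    ≡⟨ graeffe-eval g (x ℤ.* x) ⟩
  E ℤ.* E ℤ.- x ℤ.* x ℤ.* (O ℤ.* O)
    ≡⟨ eq x E O ⟩
  (E ℤ.+ x ℤ.* O) ℤ.* (E ℤ.+ ℤ.- x ℤ.* O)
    ≡⟨ cong₂ ℤ._*_ (≡.sym (even-odd g x))
         (≡.sym (≡.trans (even-odd g (ℤ.- x)) (cong (λ y → ⟦ even g ⟧ y ℤ.+ ℤ.- x ℤ.* ⟦ odd g ⟧ y) (neg² x)))) ⟩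
  ⟦ g ⟧ x ℤ.* ⟦ g ⟧ (ℤ.- x) ∎
  where
  open ≡.≡-Reasoning
  E = ⟦ even g ⟧ (x ℤ.* x)
  O = ⟦ odd g ⟧ (x ℤ.* x)
  eq : ∀ x e o → e ℤ.* e ℤ.- x ℤ.* x ℤ.* (o ℤ.* o) ≡ (e ℤ.+ x ℤ.* o) ℤ.* (e ℤ.+ ℤ.- x ℤ.* o)
  eq = solve-∀
  neg² : ∀ x → ℤ.- x ℤ.* ℤ.- x ≡ x ℤ.* x
  neg² = solve-∀

graeffe-root : ∀ {p} g x → ⟦ g ⟧ x ≡ 0ℤ [mod p ] → ⟦ graeffe g ⟧ (x ^ 2) ≡ 0ℤ [mod p ]
graeffe-root {p} g x gx≡0 = begin
  ⟦ graeffe g ⟧ (x ^ 2)        ≡⟨ graeffe-square g x ⟩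
  ⟦ g ⟧ x ℤ.* ⟦ g ⟧ (ℤ.- x)    ≈⟨ *-congʳ {⟦ g ⟧ (ℤ.- x)} {⟦ g ⟧ x} {0ℤ} gx≡0 ⟩
  0ℤ                           ∎
  where open Mod p

*≢0 : ∀ {a b} → a ≢ 0ℤ → b ≢ 0ℤ → a ℤ.* b ≢ 0ℤ
*≢0 {a} a≢0 b≢0 ab≡0 = [ a≢0 , b≢0 ]′ (ℤ.i*j≡0⇒i≡0∨j≡0 a ab≡0)

^≢0 : ∀ {a} n → a ≢ 0ℤ → a ^ n ≢ 0ℤ
^≢0 {a} n a≢0 = a≢0 ∘ ℤ.i^n≡0⇒i≡0 a n

graeffe-0 : ∀ g → ⟦ g ⟧ 0ℤ ≢ 0ℤ → ⟦ graeffe g ⟧ 0ℤ ≢ 0ℤ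
graeffe-0 g g0≢0 = subst (_≢ 0ℤ) (≡.sym (graeffe-square g 0ℤ)) (*≢0 g0≢0 g0≢0)

-- The halves E and O have the rounded-up and rounded-down half of the length of `g`, so neither E²
-- nor y O² is longer than `g`. The hypothesis excludes the empty list, which `graeffe` sends to
-- `0ℤ ∷ []`.
length-graeffe : ∀ g → ⟦ g ⟧ 0ℤ ≢ 0ℤ → length (graeffe g) ≤ length g
length-graeffe []      0≢0 = contradiction refl 0≢0
length-graeffe (c ∷ h) _   = length-⊞ (E ⊠ E) (0ℤ ∷ map (λ b → -1ℤ ℤ.* b) (O ⊠ O))
  (ℕ.≤-trans (length-⊠ E c (odd h)) (s≤s (subst (length (odd h) + length (odd h) ≤_) (length-even-odd h)
    (ℕ.+-monoˡ-≤ (length (odd h)) (length-odd≤even h)))))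
  (s≤s (subst (_≤ length h) (≡.sym (length-map _ (O ⊠ O))) (length-O⊠O h)))
  where
  E = even (c ∷ h)
  O = even h
  length-O⊠O : ∀ h → length (even h ⊠ even h) ≤ length h
  length-O⊠O [] = z≤n
  length-O⊠O (b ∷ h) = ℕ.≤-trans (length-⊠ (b ∷ odd h) b (odd h))
    (s≤s (subst (length (odd h) + length (odd h) ≤_) (length-even-odd h)
      (ℕ.+-monoˡ-≤ (length (odd h)) (length-odd≤even h))))

-- Separating a polynomial from some x^2ˢ + c^2ˢ.

-- N obstructs a common root modulo p of g and x^2ˢ + c^2ˢ, like their resultant.
Separates : ℤ[x] → ℤ → ℕ → ℤ → Set
Separates g c s N = ∀ {p} b → Prime p → ⟦ g ⟧ b ≡ 0ℤ [mod p ] →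
  b ^ (2 ℕ.^ s) ≡ ℤ.- (c ^ (2 ℕ.^ s)) [mod p ] → N ≡ 0ℤ [mod p ]

-- A common root `b` annihilates x + c or `l`. In the first case b² = c², so the power of `b` is
-- both C and -C, and 2C vanishes. In the second, b² is a common root one level down, and `N`
-- vanishes. The product 2CN covers both cases.
separates-graeffe : ∀ {s N} g l c → (∀ x → ⟦ g ⟧ x ≡ (x ℤ.+ c) ℤ.* ⟦ l ⟧ x) →
  Separates (graeffe l) (c ^ 2) s N → Separates g c (suc s) (+ 2 ℤ.* c ^ (2 ℕ.^ suc s) ℤ.* N)
separates-graeffe {s} {N} g l c g≡[x+c]l separates {p} b p-prime gb≡0 b^≡-C
  with *≡0 p-prime (b ℤ.+ c) (⟦ l ⟧ b) (Mod.≈-trans p (Mod.reflexive p (≡.sym (g≡[x+c]l b))) gb≡0)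
... | inj₁ b+c≡0 = begin
  + 2 ℤ.* C ℤ.* N                       ≈⟨ *-congʳ {N} {+ 2 ℤ.* C} {0ℤ} (begin
    + 2 ℤ.* C                             ≡⟨ double C ⟩
    C ℤ.- (ℤ.- C)                         ≈⟨ +-congˡ {C} (-‿cong (≈-sym b^≡-C)) ⟩
    C ℤ.- b ^ (2 ℕ.^ suc s)               ≡⟨ cong (λ y → C ℤ.- y) (ℤ.^-*-assoc b 2 (2 ℕ.^ s)) ⟨
    C ℤ.- (b ^ 2) ^ (2 ℕ.^ s)             ≈⟨ +-congˡ {C} (-‿cong (^-cong (2 ℕ.^ s) b²≡c²)) ⟩
    C ℤ.- (c ^ 2) ^ (2 ℕ.^ s)             ≡⟨ cong (λ y → C ℤ.- y) (ℤ.^-*-assoc c 2 (2 ℕ.^ s)) ⟩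
    C ℤ.- C                               ≡⟨ ℤ.+-inverseʳ C ⟩
    0ℤ                                    ∎) ⟩
  0ℤ                                    ∎
  where
  C = c ^ (2 ℕ.^ suc s)
  open Mod p
  double : ∀ x → + 2 ℤ.* x ≡ x ℤ.- (ℤ.- x)
  double = solve-∀
  difference : ∀ b c → b ℤ.* (b ℤ.* 1ℤ) ℤ.- c ℤ.* (c ℤ.* 1ℤ) ≡ (b ℤ.+ c) ℤ.* (b ℤ.- c)
  difference = solve-∀
  b²≡c² : b ^ 2 ≈ c ^ 2
  b²≡c² = -≡0⇒≡ (b ^ 2) (c ^ 2) (≈-trans (reflexive (difference b c))
    (*-congʳ {b ℤ.- c} {b ℤ.+ c} {0ℤ} b+c≡0))
... | inj₂ lb≡0 = begin
  + 2 ℤ.* C ℤ.* N      ≈⟨ *-congˡ {+ 2 ℤ.* C} (separates (b ^ 2) p-prime (graeffe-root l b lb≡0) b²^≡-c²^) ⟩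
  + 2 ℤ.* C ℤ.* 0ℤ     ≡⟨ ℤ.*-zeroʳ (+ 2 ℤ.* C) ⟩
  0ℤ                   ∎
  where
  C = c ^ (2 ℕ.^ suc s)
  open Mod p
  b²^≡-c²^ : (b ^ 2) ^ (2 ℕ.^ s) ≈ ℤ.- ((c ^ 2) ^ (2 ℕ.^ s))
  b²^≡-c²^ = begin
    (b ^ 2) ^ (2 ℕ.^ s)         ≡⟨ ℤ.^-*-assoc b 2 (2 ℕ.^ s) ⟩
    b ^ (2 ℕ.^ suc s)           ≈⟨ b^≡-C ⟩
    ℤ.- C                       ≡⟨ cong ℤ.-_ (ℤ.^-*-assoc c 2 (2 ℕ.^ s)) ⟨
    ℤ.- ((c ^ 2) ^ (2 ℕ.^ s))   ∎

-- For s = 0 the only candidate for a common root is -c, so the value of `g` there is the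
-- obstruction.
separates-remainder : ∀ g c → Separates g c 0 (⟦ g ⟧ (ℤ.- c))
separates-remainder g c {p} b _ gb≡0 b≡-c = ≈-trans (⟦⟧-cong g (begin
  ℤ.- c         ≡⟨ cong ℤ.-_ (ℤ.^-identityʳ c) ⟨
  ℤ.- (c ^ 1)   ≈⟨ b≡-c ⟨
  b ^ 1         ≡⟨ ℤ.^-identityʳ b ⟩
  b             ∎)) gb≡0
  where open Mod p

-- If x + c divides g, squaring the roots of the quotient leads from (g , c) to
-- a polynomial of smaller length with c² in place of c.
separation : ∀ d g c → length g ≤ d → ⟦ g ⟧ 0ℤ ≢ 0ℤ → c ≢ 0ℤ →
  Σ[ s ∈ ℕ ] Σ[ N ∈ ℤ ] (N ≢ 0ℤ × Separates g c s N)
separation d       []      c _         g0≢0 _   = contradiction refl g0≢0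
separation (suc d) (a ∷ h) c (s≤s h≤d) g0≢0 c≢0 with ⟦ a ∷ h ⟧ (ℤ.- c) ℤ.≟ 0ℤ
... | no  g[-c]≢0 = 0 , ⟦ a ∷ h ⟧ (ℤ.- c) , g[-c]≢0 , separates-remainder (a ∷ h) c
... | yes g[-c]≡0 =
  let s , N , N≢0 , separates = separation d (graeffe l) (c ^ 2)
        (ℕ.≤-trans (length-graeffe l l0≢0) (subst (_≤ d) (≡.sym (length-quotient (ℤ.- c) h)) h≤d))
        (graeffe-0 l l0≢0) (^≢0 2 c≢0)
  in suc s , + 2 ℤ.* c ^ (2 ℕ.^ suc s) ℤ.* N , *≢0 (*≢0 {+ 2} (λ ()) (^≢0 (2 ℕ.^ suc s) c≢0)) N≢0
   , separates-graeffe {s} {N} (a ∷ h) l c factorisation separates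
  where
  l = quotient (ℤ.- c) h

  factorisation : ∀ x → ⟦ a ∷ h ⟧ x ≡ (x ℤ.+ c) ℤ.* ⟦ l ⟧ x
  factorisation x = begin
    ⟦ a ∷ h ⟧ x                                            ≡⟨ remainder-theorem (ℤ.- c) a h x ⟩
    ⟦ a ∷ h ⟧ (ℤ.- c) ℤ.+ (x ℤ.- (ℤ.- c)) ℤ.* ⟦ l ⟧ x
      ≡⟨ cong₂ (λ u v → u ℤ.+ (x ℤ.+ v) ℤ.* ⟦ l ⟧ x) g[-c]≡0 (ℤ.neg-involutive c) ⟩
    0ℤ ℤ.+ (x ℤ.+ c) ℤ.* ⟦ l ⟧ x                            ≡⟨ ℤ.+-identityˡ _ ⟩
    (x ℤ.+ c) ℤ.* ⟦ l ⟧ x                                  ∎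
    where open ≡.≡-Reasoning

  l0≢0 : ⟦ l ⟧ 0ℤ ≢ 0ℤ
  l0≢0 l0≡0 = g0≢0 (≡.trans (factorisation 0ℤ)
    (≡.trans (cong (λ y → (0ℤ ℤ.+ c) ℤ.* y) l0≡0) (ℤ.*-zeroʳ (0ℤ ℤ.+ c))))

-- Odd numbers and the greatest odd divisor.

Odd : ℕ → Set
Odd m = ∃[ h ] m ≡ suc (2 * h)

half⊎odd : ∀ m → (∃[ h ] m ≡ 2 * h) ⊎ Odd m
half⊎odd zero = inj₁ (0 , refl)
half⊎odd (suc m) with half⊎odd m
... | inj₁ (h , refl) = inj₂ (h , refl)
... | inj₂ (h , refl) = inj₁ (suc h , eq h)
  where
  eq : ∀ h → 2 + 2 * h ≡ 2 * suc h
  eq = ℕ.solve-∀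

2∤⇒odd : ∀ m → 2 ∤ m → Odd m
2∤⇒odd m 2∤m with half⊎odd m
... | inj₁ (h , refl) = contradiction (m∣m*n h) 2∤m
... | inj₂ m-odd      = m-odd

odd⇒2∤ : ∀ {m} → Odd m → 2 ∤ m
odd⇒2∤ (h , refl) 2∣m = contradiction (∣1⇒≡1 (∣m+n∣m⇒∣n (subst (2 ∣_) (ℕ.+-comm 1 (2 * h)) 2∣m) (m∣m*n h))) λ ()

odd-3^ : ∀ i → Odd (3 ℕ.^ i)
odd-3^ zero = 0 , refl
odd-3^ (suc i) with h , eq ← odd-3^ i = 3 * h + 1 , ≡.trans (cong (3 *_) eq) (eq′ h)
  where
  eq′ : ∀ h → 3 * suc (2 * h) ≡ suc (2 * (3 * h + 1))
  eq′ = ℕ.solve-∀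

odd-part : ∀ m → 0 < m → ∃[ e ] ∃[ o ] (Odd o × m ≡ 2 ℕ.^ e * o)
odd-part = <-rec _ λ m rec 0<m → split m rec 0<m (half⊎odd m)
  where
  split : ∀ m → (∀ {j} → j < m → 0 < j → ∃[ e ] ∃[ o ] (Odd o × j ≡ 2 ℕ.^ e * o)) → 0 < m →
          (∃[ h ] m ≡ 2 * h) ⊎ Odd m → ∃[ e ] ∃[ o ] (Odd o × m ≡ 2 ℕ.^ e * o)
  split m rec 0<m (inj₂ m-odd) = 0 , m , m-odd , ≡.sym (ℕ.*-identityˡ m)
  split _ rec 0<m (inj₁ (suc h , refl))
    with e , o , o-odd , eq ← rec (ℕ.m<m+n (suc h) (s≤s z≤n)) (s≤s z≤n)
    = suc e , o , o-odd , ≡.trans (cong (2 *_) eq) (≡.sym (ℕ.*-assoc 2 (2 ℕ.^ e) o))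

odd-∣-cancel : ∀ {k o} e → 2 ∤ k → k ∣ 2 ℕ.^ e * o → k ∣ o
odd-∣-cancel {k} {o} zero    2∤k k∣o = subst (k ∣_) (ℕ.*-identityˡ o) k∣o
odd-∣-cancel {k} {o} (suc e) 2∤k k∣2^[1+e]o = odd-∣-cancel e 2∤k
  (coprime-divisor coprime (subst (k ∣_) (ℕ.*-assoc 2 (2 ℕ.^ e) o) k∣2^[1+e]o))
  where
  coprime : Coprime k 2
  coprime (d∣k , d∣2) with irreducible[2] d∣2
  ... | inj₁ d≡1  = d≡1
  ... | inj₂ refl = contradiction d∣k 2∤k

-- The odd part `o` of `m` is an odd divisor, hence at most the greatest one. Conversely an odd
-- divisor of 2^e * o is coprime to 2, so it divides `o`.
greatestOddDivisor-cofactor : ∀ m → 0 < m → ∃[ e ] m ≡ 2 ℕ.^ e * greatestOddDivisor m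
greatestOddDivisor-cofactor m 0<m
  with e , o , o-odd , m≡2^e*o ← odd-part m 0<m
     | k∣m , 2∤k ← greatestOddDivisor-isOddDivisor m
  = e , ≡.trans m≡2^e*o (cong (2 ℕ.^ e *_) (ℕ.≤-antisym o≤k k≤o))
  where
  o≤k : o ≤ greatestOddDivisor m
  o≤k = greatestOddDivisor-greatest m {{ℕ.>-nonZero 0<m}} o
    (divides (2 ℕ.^ e) m≡2^e*o) (odd⇒2∤ o-odd)
  k≤o : greatestOddDivisor m ≤ o
  k≤o = ∣⇒≤ {{nonZero o-odd}} (odd-∣-cancel e 2∤k (subst (greatestOddDivisor m ∣_) m≡2^e*o k∣m))
    where
    nonZero : ∀ {o} → Odd o → ℕ.NonZero o
    nonZero (_ , refl) = _

-- Roots of unity of odd and of 2-power order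

^-comm : ∀ (y : ℤ) m n → (y ^ m) ^ n ≡ (y ^ n) ^ m
^-comm y m n = ≡.trans (ℤ.^-*-assoc y m n)
  (≡.trans (cong (y ^_) (ℕ.*-comm m n)) (≡.sym (ℤ.^-*-assoc y n m)))

module _ {p : ℕ} where
  open Mod p

  1^≈1 : ∀ {y} n → y ≈ 1ℤ → y ^ n ≈ 1ℤ
  1^≈1 n y≈1 = ≈-trans (^-cong n y≈1) (reflexive (ℤ.^-zeroˡ n))

  y²≈1⇒y^odd≈y : ∀ {m} y → Odd m → y ^ 2 ≈ 1ℤ → y ^ m ≈ y
  y²≈1⇒y^odd≈y y (h , refl) y²≈1 = begin
    y ℤ.* y ^ (2 * h)    ≡⟨ cong (y ℤ.*_) (ℤ.^-*-assoc y 2 h) ⟨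
    y ℤ.* (y ^ 2) ^ h    ≈⟨ *-congˡ {y} (1^≈1 h y²≈1) ⟩
    y ℤ.* 1ℤ             ≡⟨ ℤ.*-identityʳ y ⟩
    y                    ∎

  -- The order of `y` divides both an odd number and a power of 2. Induction on `e` through the
  -- square of `y`: once `y ^ 2 ≈ 1`, an odd power of `y` is `y` itself.
  2^-odd-order : ∀ {m} e y → Odd m → y ^ m ≈ 1ℤ → y ^ (2 ℕ.^ e) ≈ 1ℤ → y ≈ 1ℤ
  2^-odd-order zero    y _     _     y≈1 = ≈-trans (reflexive (≡.sym (ℤ.^-identityʳ y))) y≈1
  2^-odd-order {m} (suc e) y m-odd y^m≈1 y^2^[1+e]≈1 =
    ≈-trans (≈-sym (y²≈1⇒y^odd≈y y m-odd (2^-odd-order e (y ^ 2) m-odd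
      (≈-trans (reflexive (^-comm y 2 m)) (1^≈1 2 y^m≈1))
      (≈-trans (reflexive (ℤ.^-*-assoc y 2 (2 ℕ.^ e))) y^2^[1+e]≈1)))) y^m≈1

  -1^odd : ∀ {m} y → Odd m → y ≈ -1ℤ → y ^ m ≈ -1ℤ
  -1^odd {m} y m-odd y≈-1 = ≈-trans (y²≈1⇒y^odd≈y y m-odd (^-cong 2 y≈-1)) y≈-1

  -- The odd power of `y ^ 2` is the square of -1, so `2^-odd-order` gives `y ^ 2 ≈ 1`; then `y`
  -- equals its odd power, which is -1.
  2^-odd-order-neg : ∀ {m} e y → Odd m → y ^ m ≈ -1ℤ → y ^ (2 ℕ.^ e) ≈ 1ℤ → y ≈ -1ℤ
  2^-odd-order-neg {m} e y m-odd y^m≈-1 y^2^e≈1 =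
    ≈-trans (≈-sym (y²≈1⇒y^odd≈y y m-odd (2^-odd-order e (y ^ 2) m-odd
      (≈-trans (reflexive (^-comm y 2 m)) (^-cong 2 y^m≈-1))
      (≈-trans (reflexive (^-comm y 2 (2 ℕ.^ e))) (1^≈1 2 y^2^e≈1))))) y^m≈-1

-- Primes modulo which -1 is a power of z² with odd exponent

-- The sixth cyclotomic polynomial: (x + 1) Φ₆(x) = x³ + 1, so its roots are cube roots of -1.
Φ₆ : ℤ → ℤ
Φ₆ x = x ℤ.* x ℤ.- x ℤ.+ 1ℤ

Φ₆-cong : ∀ {p x y} → x ≡ y [mod p ] → Φ₆ x ≡ Φ₆ y [mod p ]
Φ₆-cong {p} {x} {y} x≡y = +-congʳ {1ℤ} (+-cong (*-cong x≡y x≡y) (-‿cong x≡y))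
  where open Mod p

Φ₆-root-cube : ∀ {p} x → Φ₆ x ≡ 0ℤ [mod p ] → x ^ 3 ≡ -1ℤ [mod p ]
Φ₆-root-cube {p} x Φ₆x≡0 = begin
  x ^ 3                            ≡⟨ eq x ⟩
  (x ℤ.+ 1ℤ) ℤ.* Φ₆ x ℤ.- 1ℤ       ≈⟨ +-congʳ {ℤ.- 1ℤ} (*-congˡ {x ℤ.+ 1ℤ} Φ₆x≡0) ⟩
  (x ℤ.+ 1ℤ) ℤ.* 0ℤ ℤ.- 1ℤ         ≡⟨ cong (ℤ._- 1ℤ) (ℤ.*-zeroʳ (x ℤ.+ 1ℤ)) ⟩
  -1ℤ                              ∎
  where
  open Mod p
  eq : ∀ x → x ℤ.* (x ℤ.* (x ℤ.* 1ℤ)) ≡ (x ℤ.+ 1ℤ) ℤ.* (x ℤ.* x ℤ.- x ℤ.+ 1ℤ) ℤ.- 1ℤ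
  eq = solve-∀

-- Squares are 0 or 1 modulo 3, and `Φ₆` is 1 at both. The square matters, since `Φ₆ -1ℤ` is 3.
3∤Φ₆[z²] : ∀ z → ¬ Φ₆ (z ^ 2) ≡ 0ℤ [mod 3 ]
3∤Φ₆[z²] z Φ₆≡0 = residue (z ℤ.%ℕ 3) (ℤ.n%ℕd<d z 3)
  (≡0⇒∣ (Mod.≈-trans 3 (Φ₆-cong (^-cong 2 (Mod.≈-sym 3 (≡-remainder z 3)))) Φ₆≡0))
  where
  residue : ∀ r → r < 3 → 3 ∤ ∣ Φ₆ ((+ r) ^ 2) ∣
  -- The values are 1, 1 and 13; each quotient is split until its triple exceeds the value.
  residue 0 _ (divides (suc q) ())
  residue 1 _ (divides (suc q) ())
  residue 2 _ (divides (suc (suc (suc (suc (suc q))))) ())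
  residue (suc (suc (suc _))) (s≤s (s≤s (s≤s ())))

prime[3] : Prime 3
prime[3] = from-yes (prime? 3)

prime∣prime : ∀ {p q} → Prime p → Prime q → q ∣ p → q ≡ p
prime∣prime p-prime q-prime q∣p with prime⇒irreducible p-prime q∣p
... | inj₁ q≡1 = contradiction q≡1 (ℕ.nonTrivial⇒≢1 {{prime⇒nonTrivial q-prime}})
... | inj₂ q≡p = q≡p

prime-divisor : ∀ n → 1 < n → ∃[ p ] (Prime p × p ∣ n)
prime-divisor n 1<n with factorise n {{ℕ.>-nonZero (ℕ.<-trans (s≤s z≤n) 1<n)}}
... | record { factors = [] ; isFactorisation = refl } = contradiction 1<n λ { (s≤s ()) }
... | record { factors = p ∷ ps ; isFactorisation = refl ; factorsPrime = p-prime All.∷ _ } =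
  p , p-prime , m∣m*n _

z²≡∣z∣² : ∀ z → z ^ 2 ≡ + (∣ z ∣ * ∣ z ∣)
z²≡∣z∣² (+ n)      = ≡.trans (cong (λ y → + n ℤ.* y) (ℤ.*-identityʳ (+ n))) (≡.sym (ℤ.pos-* n n))
z²≡∣z∣² ℤ.-[1+ n ] = cong (λ y → ℤ.-[1+ n ] ℤ.* y) (ℤ.*-identityʳ ℤ.-[1+ n ])

abs-^ : ∀ z n → ∣ z ^ n ∣ ≡ ∣ z ∣ ℕ.^ n
abs-^ z zero    = refl
abs-^ z (suc n) = ≡.trans (ℤ.abs-* z (z ^ n)) (cong (∣ z ∣ *_) (abs-^ z n))

1<∣z^n∣ : ∀ {z n} → 1 < ∣ z ∣ → 0 < n → 1 < ∣ z ^ n ∣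
1<∣z^n∣ {z} {n} 1<z 0<n = subst (1 <_) (≡.sym (abs-^ z n)) (ℕ.^-monoʳ-< ∣ z ∣ 1<z 0<n)

-- Φ₆(t + 1) = 1 + t (t + 1), here with t = z² - 1 positive.
1<∣Φ₆[z²]∣ : ∀ {z} → 1 < ∣ z ∣ → 1 < ∣ Φ₆ (z ^ 2) ∣
1<∣Φ₆[z²]∣ {z} 1<z = subst (λ x → 1 < ∣ Φ₆ x ∣) (≡.sym (z²≡∣z∣² z)) (bound ∣ z ∣ 1<z)
  where
  shift : ∀ t → (1ℤ ℤ.+ t) ℤ.* (1ℤ ℤ.+ t) ℤ.- (1ℤ ℤ.+ t) ℤ.+ 1ℤ ≡ 1ℤ ℤ.+ t ℤ.* (1ℤ ℤ.+ t)
  shift = solve-∀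
  Φ₆-suc : ∀ t → Φ₆ (+ suc t) ≡ + suc (t * suc t)
  Φ₆-suc t = ≡.trans (shift (+ t)) (cong (λ y → 1ℤ ℤ.+ y) (≡.sym (ℤ.pos-* t (suc t))))
  bound : ∀ m → 1 < m → 1 < ∣ Φ₆ (+ (m * m)) ∣
  bound (suc (suc m)) _ = subst (λ x → 1 < ∣ x ∣) (≡.sym (Φ₆-suc (suc m + suc m * suc (suc m)))) (s≤s (s≤s z≤n))
  bound 1 (s≤s ())

prime-divisor-Φ₆ : ∀ z → 1 < ∣ z ∣ → ∀ i →
  ∃[ p ] (Prime p × Φ₆ ((z ^ (3 ℕ.^ i)) ^ 2) ≡ 0ℤ [mod p ])
prime-divisor-Φ₆ z 1<∣z∣ i
  with p , p-prime , p∣Φ₆ ← prime-divisor ∣ Φ₆ ((z ^ (3 ℕ.^ i)) ^ 2) ∣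
    (1<∣Φ₆[z²]∣ {z ^ (3 ℕ.^ i)} (1<∣z^n∣ {z} 1<∣z∣ (ℕ.m^n>0 3 i)))
  = p , p-prime , ∣⇒≡0 p∣Φ₆

module _ (z : ℤ) (q : ℕ → ℕ) (q-prime : ∀ i → Prime (q i))
         (q-Φ₆ : ∀ i → Φ₆ ((z ^ (3 ℕ.^ i)) ^ 2) ≡ 0ℤ [mod q i ]) where

  private
    w : ℕ → ℤ
    w i = z ^ (3 ℕ.^ i)

    w²-step : ∀ i → (w i ^ 2) ^ 3 ≡ w (suc i) ^ 2
    w²-step i = ≡.trans (^-comm (w i) 2 3) (cong (_^ 2)
      (≡.trans (ℤ.^-*-assoc z (3 ℕ.^ i) 3) (cong (z ^_) (ℕ.*-comm (3 ℕ.^ i) 3))))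

    -- Cubing passes from `w j ^ 2` to `w (suc j) ^ 2`. At index `i` the root of `Φ₆` cubes to -1,
    -- and further cubing preserves -1.
    q-1 : ∀ i j → i < j → w j ^ 2 ≡ -1ℤ [mod q i ]
    q-1 i (suc j) (s≤s i≤j) with ℕ.m≤n⇒m<n∨m≡n i≤j
    ... | inj₁ i<j  = Mod.≈-trans (q i) (Mod.reflexive (q i) (≡.sym (w²-step j)))
                        (^-cong 3 (q-1 i j i<j))
    ... | inj₂ refl = Mod.≈-trans (q i) (Mod.reflexive (q i) (≡.sym (w²-step j)))
                        (Φ₆-root-cube (w j ^ 2) (q-Φ₆ j))

    -- q i divides Φ₆ (-1) = 3 if it divides a later term.
    q-distinct : ∀ i j → i < j → q i ≢ q j
    q-distinct i j i<j qi≡qj =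
      3∤Φ₆[z²] (w i) (subst (Φ₆ (w i ^ 2) ≡ 0ℤ [mod_]) (prime∣prime prime[3] (q-prime i) q∣3) (q-Φ₆ i))
      where
      Φ₆-1≡0 : Φ₆ -1ℤ ≡ 0ℤ [mod q i ]
      Φ₆-1≡0 = Mod.≈-trans (q i) (Φ₆-cong (Mod.≈-sym (q i) (q-1 i j i<j)))
        (subst (Φ₆ (w j ^ 2) ≡ 0ℤ [mod_]) (≡.sym qi≡qj) (q-Φ₆ j))
      q∣3 : q i ∣ 3
      q∣3 = ≡0⇒∣ Φ₆-1≡0

  -- The first `2 + b` of the `q i` are distinct, while only `1 + b` naturals are at most `b`. The
  -- odd exponent is the power of 3 that `q-1` provides one index later.
  q-unbounded : ∀ b → ∃[ p ] (Prime p × b < p × ∃[ m ] (Odd m × (z ^ 2) ^ m ≡ -1ℤ [mod p ]))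
  q-unbounded b with any? (λ (i : Fin (2 + b)) → b ℕ.<? q (toℕ i))
  ... | yes (i , b<q) = q (toℕ i) , q-prime (toℕ i) , b<q , 3 ℕ.^ suc (toℕ i) , odd-3^ (suc (toℕ i))
      , Mod.≈-trans _ (Mod.reflexive _ (^-comm z 2 (3 ℕ.^ suc (toℕ i)))) (q-1 (toℕ i) (suc (toℕ i)) (ℕ.n<1+n _))
  ... | no all≤b = contradiction qi≡qj (q-distinct _ _ i<j)
    where
    q< : ∀ (i : Fin (2 + b)) → q (toℕ i) < suc b
    q< i = s≤s (ℕ.≮⇒≥ (all≤b ∘ (i ,_)))
    collision = pigeonhole (ℕ.n<1+n (suc b)) (λ i → fromℕ< (q< i))
    i = proj₁ collision
    j = proj₁ (proj₂ collision)
    i<j = proj₁ (proj₂ (proj₂ collision))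
    qi≡qj : q (toℕ i) ≡ q (toℕ j)
    qi≡qj = ≡.trans (≡.sym (toℕ-fromℕ< (q< i)))
      (≡.trans (cong toℕ (proj₂ (proj₂ (proj₂ collision)))) (toℕ-fromℕ< (q< j)))

unbounded-primes : ∀ z → 1 < ∣ z ∣ → ∀ b →
  ∃[ p ] (Prime p × b < p × ∃[ m ] (Odd m × (z ^ 2) ^ m ≡ -1ℤ [mod p ]))
unbounded-primes z 1<∣z∣ = q-unbounded z (proj₁ ∘ r) (proj₁ ∘ proj₂ ∘ r) (proj₂ ∘ proj₂ ∘ r)
  where r = prime-divisor-Φ₆ z 1<∣z∣

-- Rational polynomials in 𝒜

commonDenominator : ℚ[x] → ℤ
commonDenominator []      = 1ℤ
commonDenominator (c ∷ g) = ↧ c ℤ.* commonDenominator g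

-- The multiple of the rational polynomial by `commonDenominator`, computed without division.
clear : ℚ[x] → ℤ[x]
clear []      = []
clear (c ∷ g) = commonDenominator g ℤ.* ↥ c ∷ map (λ b → ↧ c ℤ.* b) (clear g)

commonDenominator≢0 : ∀ g → commonDenominator g ≢ 0ℤ
commonDenominator≢0 []      = λ ()
commonDenominator≢0 (c ∷ g) = *≢0 {↧ c} (λ ()) (commonDenominator≢0 g)

clear-nonZero : ∀ {g} → NonZeroPoly g → Any (_≢ 0ℤ) (clear g)
clear-nonZero {c ∷ g} (here c≢0)  = here (*≢0 (commonDenominator≢0 g) (c≢0 ∘ ℚ.↥p≡0⇒p≡0 c))
clear-nonZero {c ∷ g} (there g≢0) = there (map-nonZero (clear-nonZero g≢0))
  where
  map-nonZero : ∀ {h} → Any (_≢ 0ℤ) h → Any (_≢ 0ℤ) (map (λ b → ↧ c ℤ.* b) h)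
  map-nonZero (here b≢0)  = here (*≢0 {↧ c} (λ ()) b≢0)
  map-nonZero (there h≢0) = there (map-nonZero h≢0)

-- The finite set collects, coefficient by coefficient, the primes at which `recip` may fail to
-- invert the denominator.
clear-eval : ∀ g α → Σ[ S ∈ List ℙ ] (∀ p → p ∉ S →
  commonDenominator g ℤ.* eval g α p ≡ ⟦ clear g ⟧ (α p) [mod value p ])
clear-eval []      α = [] , λ p _ → Mod.≈-refl (value p)
clear-eval (c ∷ g) α = proj₁ inverse ++ proj₁ ih , λ p p∉ →
  step p (proj₂ inverse p (p∉ ∘ ∈-++⁺ˡ)) (proj₂ ih p (p∉ ∘ ∈-++⁺ʳ (proj₁ inverse)))
  where
  ih = clear-eval g α
  inverse : Σ[ S ∈ List ℙ ] (∀ p → p ∉ S → ↧ c ℤ.* recip (↧ₙ c) p ≡ 1ℤ [mod value p ])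
  inverse = ≈⇒agree 𝔽 (recip-inverse (↧ₙ c))
  D = commonDenominator g
  step : ∀ p → ↧ c ℤ.* recip (↧ₙ c) p ≡ 1ℤ [mod value p ] →
    D ℤ.* eval g α p ≡ ⟦ clear g ⟧ (α p) [mod value p ] →
    ↧ c ℤ.* D ℤ.* eval (c ∷ g) α p ≡ ⟦ clear (c ∷ g) ⟧ (α p) [mod value p ]
  step p d*r≡1 D*E≡L = begin
    ↧ c ℤ.* D ℤ.* (↥ c ℤ.* r ℤ.+ x ℤ.* E)
      ≡⟨ eq (↧ c) D (↥ c) r x E ⟩
    D ℤ.* ↥ c ℤ.* (↧ c ℤ.* r) ℤ.+ x ℤ.* (↧ c ℤ.* (D ℤ.* E))
      ≈⟨ +-cong (*-congˡ {D ℤ.* ↥ c} d*r≡1) (*-congˡ {x} (*-congˡ {↧ c} D*E≡L)) ⟩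
    D ℤ.* ↥ c ℤ.* 1ℤ ℤ.+ x ℤ.* (↧ c ℤ.* ⟦ clear g ⟧ x)
      ≡⟨ cong₂ (λ u v → u ℤ.+ x ℤ.* v) (ℤ.*-identityʳ (D ℤ.* ↥ c)) (≡.sym (map-*-homo (↧ c) (clear g) x)) ⟩
    ⟦ clear (c ∷ g) ⟧ x ∎
    where
    open Mod (value p)
    r = recip (↧ₙ c) p
    x = α p
    E = eval g α p
    eq : ∀ d D n r x E → d ℤ.* D ℤ.* (n ℤ.* r ℤ.+ x ℤ.* E) ≡ D ℤ.* n ℤ.* (d ℤ.* r) ℤ.+ x ℤ.* (d ℤ.* (D ℤ.* E))
    eq = solve-∀

-- `e` counts the initial zeros of the list. The nonzero value at 0 is what root squaring preserves
-- and `separation` requires.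
split-x^ : ∀ {g} → Any (_≢ 0ℤ) g →
  ∃[ e ] ∃[ l ] (⟦ l ⟧ 0ℤ ≢ 0ℤ × (∀ x → ⟦ g ⟧ x ≡ x ^ e ℤ.* ⟦ l ⟧ x))
split-x^ {c ∷ g} g≢0 with c ℤ.≟ 0ℤ
... | no c≢0 = 0 , c ∷ g , (λ c+0≡0 → c≢0 (≡.trans (≡.sym (ℤ.+-identityʳ c)) c+0≡0))
             , λ x → ≡.sym (ℤ.*-identityˡ (⟦ c ∷ g ⟧ x))
split-x^ {c ∷ g} (here c≢0)  | yes c≡0 = contradiction c≡0 c≢0
split-x^ {c ∷ g} (there g≢0) | yes c≡0 with e , l , l0≢0 , g≡x^e*l ← split-x^ g≢0
  = suc e , l , l0≢0 , λ x → begin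
    c ℤ.+ x ℤ.* ⟦ g ⟧ x            ≡⟨ cong₂ (λ u v → u ℤ.+ x ℤ.* v) c≡0 (g≡x^e*l x) ⟩
    0ℤ ℤ.+ x ℤ.* (x ^ e ℤ.* ⟦ l ⟧ x) ≡⟨ ℤ.+-identityˡ _ ⟩
    x ℤ.* (x ^ e ℤ.* ⟦ l ⟧ x)      ≡⟨ ℤ.*-assoc x (x ^ e) (⟦ l ⟧ x) ⟨
    x ^ suc e ℤ.* ⟦ l ⟧ x          ∎
  where open ≡.≡-Reasoning

-- Criteria for algebraicity and transcendence.

cube≡self⇒algebraic : ∀ a → (∀ p → a p ^ 3 ≡ a p) → Algebraic (image a)
cube≡self⇒algebraic a a³≡a = x³-x , there (here λ ()) , agree⇒≈ 𝔽 (S , vanishes)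
  where
  x³-x : ℚ[x]
  x³-x = 0ℚ ∷ ℚ.- 1ℚ ∷ 0ℚ ∷ 1ℚ ∷ []
  S = proj₁ (clear-eval x³-x a)
  -- All denominators are 1, so `clear x³-x` unfolds to this list of coefficients.
  eq : ∀ x → 0ℤ ℤ.+ x ℤ.* (-1ℤ ℤ.+ x ℤ.* (0ℤ ℤ.+ x ℤ.* (1ℤ ℤ.+ x ℤ.* 0ℤ))) ≡ x ℤ.* (x ℤ.* (x ℤ.* 1ℤ)) ℤ.- x
  eq = solve-∀
  vanishes : ∀ p → p ∉ S → eval x³-x a p ≡ 0ℤ [mod value p ]
  vanishes p p∉S = begin
    eval x³-x a p          ≡⟨ ℤ.*-identityˡ (eval x³-x a p) ⟨
    1ℤ ℤ.* eval x³-x a p   ≈⟨ proj₂ (clear-eval x³-x a) p p∉S ⟩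
    ⟦ clear x³-x ⟧ (a p)   ≡⟨ eq (a p) ⟩
    a p ^ 3 ℤ.- a p        ≡⟨ cong (ℤ._- a p) (a³≡a p) ⟩
    a p ℤ.- a p            ≡⟨ ℤ.+-inverseʳ (a p) ⟩
    0ℤ                     ∎
    where open Mod (value p)

-- The condition on `a p` disposes of the factor x^e split off by `split-x^`. Primality is restated
-- because the proof stored in `ℙ` is irrelevant.
UnboundedNonroots : (ℙ → ℤ) → Set
UnboundedNonroots a = ∀ l → ⟦ l ⟧ 0ℤ ≢ 0ℤ → ∀ b →
  Σ[ p ∈ ℙ ] (Prime (value p) × b < value p ×
    ¬ a p ≡ 0ℤ [mod value p ] × ¬ ⟦ l ⟧ (a p) ≡ 0ℤ [mod value p ])

unboundedNonroots⇒transcendental : ∀ a → UnboundedNonroots a → Transcendental (image a)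
unboundedNonroots⇒transcendental a nonroot (g , g≢0 , ga≈0) =
  let S , clear≡ = clear-eval g a
      T , ga≡0 = ≈⇒agree 𝔽 ga≈0
      e , l , l0≢0 , clear≡x^e*l = split-x^ (clear-nonZero g≢0)
      -- The relation holds outside `S ++ T`, and a prime above all of its members lies outside.
      p , p-prime , p>max , a≢0 , la≢0 = nonroot l l0≢0 (max 0 (map value (S ++ T)))
      p∉ = λ p∈ → ℕ.<⇒≱ p>max (All.lookup (xs≤max 0 (map value (S ++ T))) (∈-map⁺ value p∈))
  in [ a≢0 ∘ ^≡0 p-prime (a p) e , la≢0 ]′ (*≡0 p-prime (a p ^ e) (⟦ l ⟧ (a p))
       (vanishes p (clear≡x^e*l (a p)) (clear≡ p (p∉ ∘ ∈-++⁺ˡ)) (ga≡0 p (p∉ ∘ ∈-++⁺ʳ S))))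
  where
  D = commonDenominator g
  vanishes : ∀ p {y} → ⟦ clear g ⟧ (a p) ≡ y →
    D ℤ.* eval g a p ≡ ⟦ clear g ⟧ (a p) [mod value p ] →
    eval g a p ≡ 0ℤ [mod value p ] → y ≡ 0ℤ [mod value p ]
  vanishes p {y} clear≡y clear≡ ga≡0 = begin
    y                       ≡⟨ clear≡y ⟨
    ⟦ clear g ⟧ (a p)       ≈⟨ clear≡ ⟨
    D ℤ.* eval g a p        ≈⟨ *-congˡ {D} ga≡0 ⟩
    D ℤ.* 0ℤ                ≡⟨ ℤ.*-zeroʳ D ⟩
    0ℤ                      ∎
    where open Mod (value p)

-- The element `n ^ ((k p + 1) / 2)`.

α : ℤ → ℙ → ℤ
α n p = n ^ ((k p + 1) / 2)

∣n∣≤1⇒n³≡n : ∀ n → ¬ ∣ n ∣ > 1 → n ^ 3 ≡ n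
∣n∣≤1⇒n³≡n (+ 0)            _      = refl
∣n∣≤1⇒n³≡n (+ 1)            _      = refl
∣n∣≤1⇒n³≡n ℤ.-[1+ 0 ]       _      = refl
∣n∣≤1⇒n³≡n (+ suc (suc n))  ∣n∣≯1 = contradiction (s≤s (s≤s z≤n)) ∣n∣≯1
∣n∣≤1⇒n³≡n ℤ.-[1+ suc n ]   ∣n∣≯1 = contradiction (s≤s (s≤s z≤n)) ∣n∣≯1

-- An odd exponent is positive, so a vanishing base would give -1 ≡ 0.
^odd≡-1⇒≢0 : ∀ {p m} a → Prime p → Odd m → a ^ m ≡ -1ℤ [mod p ] → ¬ a ≡ 0ℤ [mod p ]
^odd≡-1⇒≢0 {p} a p-prime (h , refl) a^m≡-1 a≡0 =
  ℕ.nonTrivial⇒≢1 {{prime⇒nonTrivial p-prime}} (∣1⇒≡1 (≡0⇒∣ (begin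
    -1ℤ                    ≈⟨ a^m≡-1 ⟨
    a ℤ.* a ^ (2 * h)      ≈⟨ *-congʳ {a ^ (2 * h)} a≡0 ⟩
    0ℤ                     ∎)))
  where open Mod p

-- X^(p - 1) ≡ 1, so X^k has order a power of 2 modulo p; it also has an odd power ≡ -1.
^greatestOddDivisor≡-1 : ∀ {p m} X → Prime p → Odd m → X ^ m ≡ -1ℤ [mod p ] →
  X ^ greatestOddDivisor (p ∸ 1) ≡ -1ℤ [mod p ]
^greatestOddDivisor≡-1 {p} {m} X p-prime m-odd X^m≡-1
  with e , p-1≡2^e*K ← greatestOddDivisor-cofactor (p ∸ 1)
         (ℕ.m<n⇒0<n∸m (ℕ.nonTrivial⇒n>1 p {{prime⇒nonTrivial p-prime}}))
  = 2^-odd-order-neg e (X ^ K) m-odd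
      (≈-trans (reflexive (^-comm X K m)) (-1^odd (X ^ m) K-odd X^m≡-1))
      (begin
        (X ^ K) ^ (2 ℕ.^ e)   ≡⟨ ^-comm X K (2 ℕ.^ e) ⟩
        (X ^ (2 ℕ.^ e)) ^ K   ≡⟨ ℤ.^-*-assoc X (2 ℕ.^ e) K ⟩
        X ^ (2 ℕ.^ e * K)     ≡⟨ cong (X ^_) p-1≡2^e*K ⟨
        X ^ (p ∸ 1)           ≈⟨ fermat-unit p-prime X (^odd≡-1⇒≢0 X p-prime m-odd X^m≡-1) ⟩
        1ℤ                    ∎)
  where
  K = greatestOddDivisor (p ∸ 1)
  K-odd : Odd K
  K-odd = 2∤⇒odd K (proj₂ (greatestOddDivisor-isOddDivisor (p ∸ 1)))
  open Mod p

-- `k p` is odd, so halving `k p + 1` is exact.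
α² : ∀ n p → α n p ^ 2 ≡ n ^ suc (k p)
α² n p with h , k≡1+2h ← 2∤⇒odd (k p) (proj₂ (greatestOddDivisor-isOddDivisor (value p ∸ 1))) = begin
  α n p ^ 2                       ≡⟨ ℤ.^-*-assoc n ((k p + 1) / 2) 2 ⟩
  n ^ ((k p + 1) / 2 * 2)         ≡⟨ cong (λ j → n ^ ((j + 1) / 2 * 2)) k≡1+2h ⟩
  n ^ ((suc (2 * h) + 1) / 2 * 2) ≡⟨ cong (λ j → n ^ (j / 2 * 2)) (eq h) ⟩
  n ^ (suc h * 2 / 2 * 2)         ≡⟨ cong (λ j → n ^ (j * 2)) (m*n/n≡m (suc h) 2) ⟩
  n ^ (suc h * 2)                 ≡⟨ cong (n ^_) (eq′ h) ⟩
  n ^ suc (suc (2 * h))           ≡⟨ cong (λ j → n ^ suc j) k≡1+2h ⟨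
  n ^ suc (k p)                   ∎
  where
  open ≡.≡-Reasoning
  eq : ∀ h → suc (2 * h) + 1 ≡ suc h * 2
  eq = ℕ.solve-∀
  eq′ : ∀ h → suc h * 2 ≡ suc (suc (2 * h))
  eq′ = ℕ.solve-∀

-- The left side is X^(k + 1) = X * X^k. The fourth power brings in n² instead of n, matching primes
-- that are constructed for squares; `s` is the whole exponent, later `2 ℕ.^ s`.
α⁴^≡-X : ∀ n p s → let X = (n ^ 2) ^ s in X ^ k p ≡ -1ℤ [mod value p ] →
  ((α n p ^ 2) ^ 2) ^ s ≡ ℤ.- X [mod value p ]
α⁴^≡-X n p s X^k≡-1 = begin
  ((α n p ^ 2) ^ 2) ^ s             ≡⟨ cong (λ y → (y ^ 2) ^ s) (α² n p) ⟩
  ((n ^ suc (k p)) ^ 2) ^ s         ≡⟨ cong (_^ s) (^-comm n (suc (k p)) 2) ⟩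
  ((n ^ 2) ^ suc (k p)) ^ s         ≡⟨ ^-comm (n ^ 2) (suc (k p)) s ⟩
  X ℤ.* X ^ k p                     ≈⟨ *-congˡ {X} X^k≡-1 ⟩
  X ℤ.* -1ℤ                         ≡⟨ eq X ⟩
  ℤ.- X                             ∎
  where
  open Mod (value p)
  X = (n ^ 2) ^ s
  eq : ∀ x → x ℤ.* -1ℤ ≡ ℤ.- x
  eq = solve-∀

α≢0 : ∀ {n m s} p → Prime (value p) → Odd m → ((n ^ s) ^ 2) ^ m ≡ -1ℤ [mod value p ] → 0 < s →
  ¬ α n p ≡ 0ℤ [mod value p ]
α≢0 {n} {m} {suc s} p p-prime m-odd X^m≡-1 _ α≡0 = ^odd≡-1⇒≢0 ((n ^ suc s) ^ 2) p-prime m-odd X^m≡-1 (begin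
  (n ^ suc s) ^ 2
    ≈⟨ *-congʳ {(n ^ suc s) ^ 1} (*-congʳ {n ^ s} (^≡0 p-prime n ((k p + 1) / 2) α≡0)) ⟩
  0ℤ                              ∎)
  where open Mod (value p)

-- The fourth power of `α n p` is a common root modulo p of the twice transformed `l` and of x^2ˢ +
-- (n²)^2ˢ.
separates-α : ∀ {s N m} n l (p : ℙ) → Separates (graeffe (graeffe l)) (n ^ 2) s N →
  Prime (value p) → Odd m → ((n ^ (2 ℕ.^ s)) ^ 2) ^ m ≡ -1ℤ [mod value p ] →
  ⟦ l ⟧ (α n p) ≡ 0ℤ [mod value p ] → N ≡ 0ℤ [mod value p ]
separates-α {s} {N} {m} n l p separates p-prime m-odd X^m≡-1 lα≡0 =
  separates ((α n p ^ 2) ^ 2) p-prime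
    (graeffe-root (graeffe l) (α n p ^ 2) (graeffe-root l (α n p) lα≡0))
    (α⁴^≡-X n p (2 ℕ.^ s) (^greatestOddDivisor≡-1 ((n ^ 2) ^ (2 ℕ.^ s)) p-prime m-odd
      (subst (λ x → x ^ m ≡ -1ℤ [mod value p ]) (^-comm n (2 ℕ.^ s) 2) X^m≡-1)))

unboundedNonroots : ∀ n → ∣ n ∣ > 1 → UnboundedNonroots (α n)
unboundedNonroots n ∣n∣>1 l l0≢0 b = avoid
  (separation (length (graeffe (graeffe l))) (graeffe (graeffe l)) (n ^ 2) ℕ.≤-refl
    (graeffe-0 (graeffe l) (graeffe-0 l l0≢0)) (^≢0 {n} 2 n≢0))
  where
  n≢0 : n ≢ 0ℤ
  n≢0 refl = contradiction ∣n∣>1 λ ()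
  Goal : Set
  Goal = Σ[ p ∈ ℙ ] (Prime (value p) × b < value p ×
    ¬ α n p ≡ 0ℤ [mod value p ] × ¬ ⟦ l ⟧ (α n p) ≡ 0ℤ [mod value p ])
  avoid : Σ[ s ∈ ℕ ] Σ[ N ∈ ℤ ] (N ≢ 0ℤ × Separates (graeffe (graeffe l)) (n ^ 2) s N) → Goal
  avoid (s , N , N≢0 , separates) =
    -- The square of the base is X = (n²)^2ˢ. A prime above `∣ N ∣` cannot divide the nonzero `N`;
    -- the summand `b` gives the required size.
    large (unbounded-primes (n ^ (2 ℕ.^ s)) (1<∣z^n∣ {n} ∣n∣>1 (ℕ.m^n>0 2 s)) (b + ∣ N ∣))
    where
    large : ∃[ p ] (Prime p × b + ∣ N ∣ < p ×
      ∃[ m ] (Odd m × ((n ^ (2 ℕ.^ s)) ^ 2) ^ m ≡ -1ℤ [mod p ])) → Goal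
    large (p , p-prime , b+N<p , m , m-odd , X^m≡-1) =
      P , p-prime , ℕ.≤-<-trans (ℕ.m≤m+n b ∣ N ∣) b+N<p
      , α≢0 {n} {m} {2 ℕ.^ s} P p-prime m-odd X^m≡-1 (ℕ.m^n>0 2 s)
      , λ lα≡0 → >⇒∤ {{ℕ.≢-nonZero (N≢0 ∘ ℤ.∣i∣≡0⇒i≡0)}}
          (ℕ.≤-<-trans (ℕ.m≤n+m ∣ N ∣ b) b+N<p)
          (≡0⇒∣ (separates-α {s} {N} {m} n l P separates p-prime m-odd X^m≡-1 lα≡0))
      where
      P : ℙ
      P = p , [ p-prime ]

theorem1p9 : ∀ (n : ℤ) →
    Transcendental (image (λ p → n ^ ((k p + 1) / 2))) ⇔ ∣ n ∣ > 1
theorem1p9 n = mk⇔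
  (λ α-transcendental → decidable-stable (1 ℕ.<? ∣ n ∣) λ ∣n∣≯1 → α-transcendental
    (cube≡self⇒algebraic a λ p → ≡.trans (^-comm n ((k p + 1) / 2) 3)
      (cong (_^ ((k p + 1) / 2)) (∣n∣≤1⇒n³≡n n ∣n∣≯1))))
  (λ ∣n∣>1 → unboundedNonroots⇒transcendental a (unboundedNonroots n ∣n∣>1))
  where
  a : ℙ → ℤ
  a = λ p → n ^ ((k p + 1) / 2)
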